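{- For any two integers $p,q$ with $1\le p\le q$, the following are equivalent: (a) $\mathrm{PCSP}(\mathbf{K}_p,\mathbf{K}_q)$ is solvable by the consistency algorithm in width $3$; (b) it is solvable in bounded width; (c) it is solvable in sublinear width; (d) $p=1$ or $p=2$.
   Context: $\mathbf{K}_m$ is the complete loopless graph on $m$ vertices, viewed as a structure with one binary (symmetric, irreflexive) edge relation; instances are structures with one binary relation. A partial homomorphism from $\mathbf{I}$ to $\mathbf{S}$ is a map $f:X\to S$, $X\subseteq I$, that is a homomorphism from the induced substructure $\mathbf{I}|_X$ to $\mathbf{S}$. A $k$-strategy on $\mathbf{I}$ and $\mathbf{S}$ is a nonempty collection $\mathscr{H}$ of partial homomorphisms closed under restrictions and such that for every $h\in\mathscr{H}$ with $|\mathrm{dom}(h)|<k$ and every $x\in I\setminus\mathrm{dom}(h)$ some $f\in\mathscr{H}$ extends $h$ with $\mathrm{dom}(f)=\mathrm{dom}(h)\cup\{x\}$; $\mathbf{I}\le_k\mathbf{S}$ means one exists. $\mathrm{PCSP}(\mathbf{K}_p,\mathbf{K}_q)$ is solvable in width $k(n)$ if for every instance $\mathbf{I}$ with $n$ elements, $\mathbf{I}\le_{k(n)}\mathbf{K}_p$ implies $\mathbf{I}\to\mathbf{K}_q$; bounded width means width $k(n)$ for some $k(n)=O(1)$, sublinear width for some $k(n)=o(n)$. -}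

module Defs where

open import Data.Nat using (ℕ; _≤_; _<_; _*_)
open import Data.Fin using (Fin)
open import Data.Fin.Subset using (Subset; _∈_; _∉_; _⊆_; _∪_; ⁅_⁆; ∣_∣)
open import Data.Bool using (Bool; true)
open import Data.Product using (Σ; ∃; _×_; _,_)
open import Relation.Binary.PropositionalEquality using (_≡_; _≢_)

record Instance : Set where
  constructor inst
  field
    size : ℕ
    rel  : Fin size → Fin size → Bool
open Instance public

KEdge : ∀ {m} → Fin m → Fin m → Set
KEdge a b = a ≢ b

Hom : (I : Instance) (m : ℕ) → Set
Hom I m = Σ (Fin (size I) → Fin m) λ f →
  ∀ x y → rel I x y ≡ true → KEdge (f x) (f y)

-- A partial map with domain X is represented by (X , f) with f total;
-- only the values of f on X matter.
IsPartialHom : (I : Instance) (m : ℕ) → Subset (size I) → (Fin (size I) → Fin m) → Set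
IsPartialHom I m X f =
  ∀ x y → x ∈ X → y ∈ X → rel I x y ≡ true → KEdge (f x) (f y)

record IsStrategy (k : ℕ) (I : Instance) (m : ℕ)
       (ℋ : Subset (size I) → (Fin (size I) → Fin m) → Set) : Set where
  field
    members-hom : ∀ X f → ℋ X f → IsPartialHom I m X f
    nonempty    : Σ (Subset (size I)) λ X → Σ (Fin (size I) → Fin m) λ f → ℋ X f
    restrict    : ∀ X Y f → ℋ X f → Y ⊆ X → ℋ Y f
    extend      : ∀ X f → ℋ X f → ∣ X ∣ < k → ∀ x → x ∉ X →
                  Σ (Fin (size I) → Fin m) λ g →
                    ℋ (⁅ x ⁆ ∪ X) g × (∀ y → y ∈ X → g y ≡ f y)

_≤[_]K_ : Instance → ℕ → ℕ → Set₁
I ≤[ k ]K m = Σ (Subset (size I) → (Fin (size I) → Fin m) → Set) λ ℋ → IsStrategy k I m ℋ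

SolvableInWidth : (p q : ℕ) → (ℕ → ℕ) → Set₁
SolvableInWidth p q k = ∀ (I : Instance) → I ≤[ k (size I) ]K p → Hom I q

IsBigO1 : (ℕ → ℕ) → Set
IsBigO1 k = Σ ℕ λ c → Σ ℕ λ N → ∀ n → N ≤ n → k n ≤ c

IsLittleOn : (ℕ → ℕ) → Set
IsLittleOn k = ∀ m → 1 ≤ m → Σ ℕ λ N → ∀ n → N ≤ n → m * k n ≤ n

BoundedWidth : ℕ → ℕ → Set₁
BoundedWidth p q = Σ (ℕ → ℕ) λ k → IsBigO1 k × SolvableInWidth p q k

SublinearWidth : ℕ → ℕ → Set₁
SublinearWidth p q = Σ (ℕ → ℕ) λ k → IsLittleOn k × SolvableInWidth p q k

{-# OPTIONS --safe #-}
module Submission where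

-- The substance is that K_p against K_q needs linear width when p ≥ 3.  A random sequence of D n
-- edges on n vertices, D large in terms of q, has the following two properties with positive
-- probability, by a union bound carried out as weighted counting in ℕ:
--   * each set of at least n / q vertices contains an edge, so there is no proper q-colouring;
--   * each nonempty set of s ≤ ε n vertices spans at most 4 s / 3 edges.
-- Call T bad for X if every vertex of T has at least 3 neighbours in X ∪ T.  Sparsity bounds a bad
-- set that is not too large by 8 |X|, so X has a largest small bad set T, and X ∪ T serves as a
-- closure of X.  The partial colourings of X that extend properly to the closure form a strategy:
-- passing to the closure of one more point never requires recolouring, because the new vertices can
-- be ordered so that each has at most two neighbours before it, and there are at least three colours.
--
-- For p = 2, width 3 makes the relation "every member of the strategy gives x and y the same
-- (resp. different) colours" transitive, and a 2-colouring is built by merging components.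

open import Defs
open import Data.Bool using (Bool; true; false; if_then_else_; _∧_; not; _xor_)
import Data.Bool as Bool
open import Data.Bool.Properties using (xor-assoc; xor-same; xor-identityʳ)
open import Data.Empty using (⊥; ⊥-elim)
open import Data.Fin using (Fin; zero; suc)
import Data.Fin as Fin
open import Data.Fin.Properties using (¬∀⟶∃¬; all?)
open import Data.Fin.Subset using (Subset; ∣_∣; _∪_; _⊆_; ⁅_⁆; _-_)
  renaming (_∈_ to _∈ˢ_; _∉_ to _∉ˢ_; ⊥ to ∅)
open import Data.Fin.Subset.Properties
  using (∉⊥; ⊥⊆; x∈p∪q⁻; p⊆p∪q; q⊆p∪q; p⊆q⇒∣p∣≤∣q∣; ∣q∣≤∣p∪q∣; x∈p⇒∣p-x∣<∣p∣;
         x∈p∧x≢y⇒x∈p-y; p─q⊆p; x∈⁅x⁆; x∈⁅y⁆⇒x≡y; ∣⊥∣≡0; ∣⁅x⁆∣≡1)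
  renaming (_∈?_ to _∈ˢ?_)
open import Data.List
  using (List; []; _∷_; _++_; map; length; cartesianProductWith; cartesianProduct; allFin; upTo; applyUpTo)
open import Data.List.Membership.Propositional using () renaming (_∈_ to _∈ˡ_; _∉_ to _∉ˡ_)
import Data.List.Membership.DecPropositional as DecMembership
open import Data.List.Membership.Propositional.Properties
  using (∈-cartesianProductWith⁺; ∈-cartesianProduct⁺; ∈-upTo⁺; ∈-allFin; ∈-++⁺ˡ; ∈-++⁺ʳ; ∈-map⁺)
open import Data.List.Properties using (map-tabulate; map-applyUpTo; length-++; length-map)
open import Data.List.Relation.Unary.Any using (here; there)
open import Data.Nat
  using (ℕ; zero; suc; pred; _+_; _*_; _∸_; _^_; _⊔_; _≤_; _<_; z≤n; s≤s; NonZero; _≤?_; _<?_; >-nonZero)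
open import Data.Nat.ListAction using (sum)
open import Data.Nat.Properties
open import Data.Nat.Tactic.RingSolver using (solve-∀)
open import Data.Product using (Σ; ∃; _×_; _,_; proj₁; proj₂)
import Data.Product.Properties as Prod
open import Data.Sum using (_⊎_; inj₁; inj₂; [_,_]′)
open import Data.Vec using (Vec; []; _∷_; lookup; tabulate)
open import Data.Vec.Membership.Propositional using (_∈_)
import Data.Vec.Membership.DecPropositional as DecVecMembership
open import Data.Vec.Properties using (lookup⇒[]=; []=⇒lookup; lookup∘tabulate)
import Data.Vec.Relation.Unary.Any as VecAny
open import Function using (_∘_; id)
open import Function.Bundles using (_⇔_; mk⇔)
open import Relation.Binary.PropositionalEquality
  using (_≡_; _≢_; refl; sym; trans; cong; cong₂; subst; module ≡-Reasoning)
open import Relation.Nullary using (¬_; Dec; yes; no; contradiction; ⌊_⌋; ¬?)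
open import Relation.Nullary.Decidable using (_×-dec_; _→-dec_)

-- Finite sums over lists.

∑ : {A : Set} → List A → (A → ℕ) → ℕ
∑ xs f = sum (map f xs)

module _ {A : Set} where

  ∑-mono : ∀ (xs : List A) {f g : A → ℕ} → (∀ x → f x ≤ g x) → ∑ xs f ≤ ∑ xs g
  ∑-mono []       f≤g = z≤n
  ∑-mono (x ∷ xs) f≤g = +-mono-≤ (f≤g x) (∑-mono xs f≤g)

  ∑-cong : ∀ (xs : List A) {f g : A → ℕ} → (∀ x → f x ≡ g x) → ∑ xs f ≡ ∑ xs g
  ∑-cong []       f≡g = refl
  ∑-cong (x ∷ xs) f≡g = cong₂ _+_ (f≡g x) (∑-cong xs f≡g)

  ∑-distrib-+ : ∀ (xs : List A) (f g : A → ℕ) → ∑ xs (λ x → f x + g x) ≡ ∑ xs f + ∑ xs g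
  ∑-distrib-+ []       f g = refl
  ∑-distrib-+ (x ∷ xs) f g =
    trans (cong (f x + g x +_) (∑-distrib-+ xs f g)) (interchange (f x) (g x) (∑ xs f) (∑ xs g))
    where
    interchange : ∀ a b c d → a + b + (c + d) ≡ a + c + (b + d)
    interchange = solve-∀

  ∑-distribˡ-* : ∀ (xs : List A) c (f : A → ℕ) → ∑ xs (λ x → c * f x) ≡ c * ∑ xs f
  ∑-distribˡ-* []       c f = sym (*-zeroʳ c)
  ∑-distribˡ-* (x ∷ xs) c f =
    trans (cong (c * f x +_) (∑-distribˡ-* xs c f)) (sym (*-distribˡ-+ c (f x) (∑ xs f)))

  ∑-distribʳ-* : ∀ (xs : List A) c (f : A → ℕ) → ∑ xs (λ x → f x * c) ≡ ∑ xs f * c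
  ∑-distribʳ-* xs c f = trans (∑-cong xs (λ x → *-comm (f x) c))
    (trans (∑-distribˡ-* xs c f) (*-comm c (∑ xs f)))

  ∑-++ : ∀ (xs ys : List A) (f : A → ℕ) → ∑ (xs ++ ys) f ≡ ∑ xs f + ∑ ys f
  ∑-++ []       ys f = refl
  ∑-++ (x ∷ xs) ys f = trans (cong (f x +_) (∑-++ xs ys f)) (sym (+-assoc (f x) (∑ xs f) (∑ ys f)))

  ∑-0 : ∀ (xs : List A) → ∑ xs (λ _ → 0) ≡ 0
  ∑-0 []       = refl
  ∑-0 (x ∷ xs) = ∑-0 xs

  ∑≡0⇒≡0 : ∀ {xs : List A} {f : A → ℕ} → ∑ xs f ≡ 0 → ∀ {x} → x ∈ˡ xs → f x ≡ 0
  ∑≡0⇒≡0 {x ∷ xs} {f} eq (here refl) = m+n≡0⇒m≡0 (f x) eq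
  ∑≡0⇒≡0 {x ∷ xs} {f} eq (there p)   = ∑≡0⇒≡0 (m+n≡0⇒n≡0 (f x) eq) p

  -- Serves both as the first-moment method, when the edge sequence is chosen, and as the pigeonhole
  -- principle for colour classes.
  ∑<⇒∃< : ∀ (xs : List A) {f g : A → ℕ} → ∑ xs f < ∑ xs g → ∃ λ x → f x < g x
  ∑<⇒∃< (x ∷ xs) {f} {g} lt with f x <? g x
  ... | yes fx<gx = x , fx<gx
  ... | no  fx≮gx = ∑<⇒∃< xs (≰⇒> λ le → <⇒≱ lt (+-mono-≤ (≮⇒≥ fx≮gx) le))

module _ {A B : Set} where

  ∑-map : ∀ (g : A → B) (xs : List A) (f : B → ℕ) → ∑ (map g xs) f ≡ ∑ xs (f ∘ g)
  ∑-map g []       f = refl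
  ∑-map g (x ∷ xs) f = cong (f (g x) +_) (∑-map g xs f)

  ∑-swap : ∀ (xs : List A) (ys : List B) (f : A → B → ℕ) →
           ∑ xs (λ x → ∑ ys (f x)) ≡ ∑ ys (λ y → ∑ xs (λ x → f x y))
  ∑-swap []       ys f = sym (∑-0 ys)
  ∑-swap (x ∷ xs) ys f =
    trans (cong (∑ ys (f x) +_) (∑-swap xs ys f)) (sym (∑-distrib-+ ys (f x) _))

∑-cartesianProductWith : ∀ {A B C : Set} (g : A → B → C) (xs : List A) (ys : List B) (f : C → ℕ) →
  ∑ (cartesianProductWith g xs ys) f ≡ ∑ xs (λ x → ∑ ys (λ y → f (g x y)))
∑-cartesianProductWith g []       ys f = refl
∑-cartesianProductWith g (x ∷ xs) ys f =
  trans (∑-++ (map (g x) ys) _ f)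
        (cong₂ _+_ (∑-map (g x) ys f) (∑-cartesianProductWith g xs ys f))

-- Words over a finite alphabet, and indicators.

words : {A : Set} → List A → ∀ m → List (Vec A m)
words xs zero    = [] ∷ []
words xs (suc m) = cartesianProductWith _∷_ xs (words xs m)

∈-words : ∀ {A : Set} {xs : List A} → (∀ x → x ∈ˡ xs) → ∀ {m} (w : Vec A m) → w ∈ˡ words xs m
∈-words all []      = here refl
∈-words all (x ∷ w) = ∈-cartesianProductWith⁺ _∷_ (all x) (∈-words all w)

∏ : ∀ {A : Set} {m} → (A → ℕ) → Vec A m → ℕ
∏ t []      = 1
∏ t (x ∷ w) = t x * ∏ t w

-- Independence of the coordinates of a uniform word: the mean of a product is the product of the
-- means, here without normalisation.
∑-words-∏ : ∀ {A : Set} (xs : List A) (t : A → ℕ) m → ∑ (words xs m) (∏ t) ≡ ∑ xs t ^ m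
∑-words-∏ xs t zero    = refl
∑-words-∏ xs t (suc m) = begin
  ∑ (words xs (suc m)) (∏ t)                          ≡⟨ ∑-cartesianProductWith _∷_ xs (words xs m) (∏ t) ⟩
  ∑ xs (λ x → ∑ (words xs m) (λ w → t x * ∏ t w))     ≡⟨ ∑-cong xs (λ x → ∑-distribˡ-* (words xs m) (t x) (∏ t)) ⟩
  ∑ xs (λ x → t x * ∑ (words xs m) (∏ t))             ≡⟨ ∑-distribʳ-* xs (∑ (words xs m) (∏ t)) t ⟩
  ∑ xs t * ∑ (words xs m) (∏ t)                       ≡⟨ cong (∑ xs t *_) (∑-words-∏ xs t m) ⟩
  ∑ xs t * ∑ xs t ^ m                                 ∎
  where open ≡-Reasoning

∏-1 : ∀ {A : Set} {m} (w : Vec A m) → ∏ (λ _ → 1) w ≡ 1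
∏-1 []      = refl
∏-1 (x ∷ w) = trans (+-identityʳ _) (∏-1 w)

⟦_⟧ : Bool → ℕ
⟦ false ⟧ = 0
⟦ true  ⟧ = 1

∑-allFin-suc : ∀ n (f : Fin (suc n) → ℕ) → ∑ (allFin (suc n)) f ≡ f zero + ∑ (allFin n) (f ∘ suc)
∑-allFin-suc n f = cong (λ l → f zero + sum l)
  (trans (map-tabulate suc f) (sym (map-tabulate id (f ∘ suc))))

∑-allFin-1 : ∀ n → ∑ (allFin n) (λ _ → 1) ≡ n
∑-allFin-1 zero    = refl
∑-allFin-1 (suc n) = trans (∑-allFin-suc n (λ _ → 1)) (cong suc (∑-allFin-1 n))

∑-lookup : ∀ {n} (S : Subset n) → ∑ (allFin n) (λ v → ⟦ lookup S v ⟧) ≡ ∣ S ∣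
∑-lookup []          = refl
∑-lookup (true  ∷ S) = trans (∑-allFin-suc _ (λ v → ⟦ lookup (true ∷ S) v ⟧)) (cong suc (∑-lookup S))
∑-lookup (false ∷ S) = trans (∑-allFin-suc _ (λ v → ⟦ lookup (false ∷ S) v ⟧)) (∑-lookup S)

∑-≟ : ∀ {n} (u : Fin n) → ∑ (allFin n) (λ v → ⟦ ⌊ u Fin.≟ v ⌋ ⟧) ≡ 1
∑-≟ {suc n} zero    = trans (∑-allFin-suc n (λ v → ⟦ ⌊ zero Fin.≟ v ⌋ ⟧)) (cong suc (∑-0 (allFin n)))
∑-≟ {suc n} (suc u) = trans (∑-allFin-suc n (λ v → ⟦ ⌊ suc u Fin.≟ v ⌋ ⟧)) (trans (∑-cong (allFin n) same) (∑-≟ u))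
  where
  same : ∀ v → ⟦ ⌊ suc u Fin.≟ suc v ⌋ ⟧ ≡ ⟦ ⌊ u Fin.≟ v ⌋ ⟧
  same v with u Fin.≟ v
  ... | yes _ = refl
  ... | no  _ = refl

-- Elementary inequalities

^-distribʳ-* : ∀ m n k → (m * n) ^ k ≡ m ^ k * n ^ k
^-distribʳ-* m n zero    = refl
^-distribʳ-* m n (suc k) = trans (cong (m * n *_) (^-distribʳ-* m n k)) (swap m n (m ^ k) (n ^ k))
  where
  swap : ∀ a b c d → a * b * (c * d) ≡ a * c * (b * d)
  swap = solve-∀

bernoulli : ∀ a k → a ^ suc k + suc k * a ^ k ≤ suc a ^ suc k
bernoulli a zero    = ≤-reflexive (base a)
  where
  base : ∀ a → a * 1 + 1 * 1 ≡ (1 + a) * 1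
  base = solve-∀
bernoulli a (suc k) = begin
  a ^ suc (suc k) + suc (suc k) * a ^ suc k                      ≤⟨ m≤m+n _ (suc k * a ^ k) ⟩
  a ^ suc (suc k) + suc (suc k) * a ^ suc k + suc k * a ^ k      ≡⟨ expand a k (a ^ k) ⟩
  suc a * (a ^ suc k + suc k * a ^ k)                            ≤⟨ *-monoʳ-≤ (suc a) (bernoulli a k) ⟩
  suc a ^ suc (suc k)                                            ∎
  where
  open ≤-Reasoning
  expand : ∀ a k p → a * (a * p) + (2 + k) * (a * p) + (1 + k) * p ≡ (1 + a) * (a * p + (1 + k) * p)
  expand = solve-∀

2*a^a≤[1+a]^a : ∀ a → 1 ≤ a → 2 * a ^ a ≤ suc a ^ a
2*a^a≤[1+a]^a (suc k) _ = ≤-trans (≤-reflexive (cong (suc k ^ suc k +_) (+-identityʳ _)))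
  (bernoulli (suc k) k)

-- Bernoulli's (1 − 1/(1+z))^k ≥ 1 − k/(1+z), cleared of denominators and of subtraction.
[1+z]^k[1+z]≤z^k[1+z]+k[1+z]^k : ∀ z k → suc z ^ k * suc z ≤ z ^ k * suc z + k * suc z ^ k
[1+z]^k[1+z]≤z^k[1+z]+k[1+z]^k z zero    = m≤m+n _ _
[1+z]^k[1+z]≤z^k[1+z]+k[1+z]^k z (suc k) = begin
  suc z ^ suc k * suc z                                            ≡⟨ e₁ z (suc z ^ k) ⟩
  z * (suc z ^ k * suc z) + suc z ^ suc k                          ≤⟨ +-monoˡ-≤ _ (*-monoʳ-≤ z ([1+z]^k[1+z]≤z^k[1+z]+k[1+z]^k z k)) ⟩
  z * (z ^ k * suc z + k * suc z ^ k) + suc z ^ suc k              ≤⟨ m≤m+n _ (k * suc z ^ k) ⟩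
  z * (z ^ k * suc z + k * suc z ^ k) + suc z ^ suc k + k * suc z ^ k ≡⟨ e₂ z k (z ^ k) (suc z ^ k) ⟩
  z ^ suc k * suc z + suc k * suc z ^ suc k                        ∎
  where
  open ≤-Reasoning
  e₁ : ∀ z p → (1 + z) * p * (1 + z) ≡ z * (p * (1 + z)) + (1 + z) * p
  e₁ = solve-∀
  e₂ : ∀ z k r p → z * (r * (1 + z) + k * p) + (1 + z) * p + k * p
                 ≡ z * r * (1 + z) + (1 + k) * ((1 + z) * p)
  e₂ = solve-∀

-- The preceding inequality at z = 2h and k = h gives (1 - 1/(1 + 2h))^h ≥ (1 + h)/(1 + 2h), which
-- is at least 1/2.
[1+2h]^h≤2[2h]^h : ∀ h → suc (2 * h) ^ h ≤ 2 * (2 * h) ^ h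
[1+2h]^h≤2[2h]^h h = *-cancelʳ-≤ _ _ (suc h) (+-cancelʳ-≤ (h * p) _ _ (begin
  p * suc h + h * p                      ≡⟨ e₁ h p ⟩
  p * suc (2 * h)                        ≤⟨ [1+z]^k[1+z]≤z^k[1+z]+k[1+z]^k (2 * h) h ⟩
  r * suc (2 * h) + h * p                ≤⟨ +-monoˡ-≤ (h * p) (m≤m+n _ r) ⟩
  r * suc (2 * h) + r + h * p            ≡⟨ cong (_+ h * p) (e₂ h r) ⟩
  2 * r * suc h + h * p                  ∎))
  where
  open ≤-Reasoning
  p = suc (2 * h) ^ h
  r = (2 * h) ^ h
  e₁ : ∀ h p → p * (1 + h) + h * p ≡ p * (1 + 2 * h)
  e₁ = solve-∀
  e₂ : ∀ h r → r * (1 + 2 * h) + r ≡ 2 * r * (1 + h)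
  e₂ = solve-∀

-- (1 + 1/z)^n increases with n; the factor z^(m - n) replaces the quotient.
^-ratio-antitone : ∀ z c {m n} → 1 ≤ z → n ≤ m → suc z ^ m ≤ c * z ^ m → suc z ^ n ≤ c * z ^ n
^-ratio-antitone z@(suc _) c {m} {n} _ n≤m le =
  *-cancelʳ-≤ _ _ (z ^ (m ∸ n)) {{m^n≢0 z (m ∸ n)}} (begin
    suc z ^ n * z ^ (m ∸ n)         ≤⟨ *-monoʳ-≤ (suc z ^ n) (^-monoˡ-≤ (m ∸ n) (n≤1+n z)) ⟩
    suc z ^ n * suc z ^ (m ∸ n)     ≡⟨ ^-distribˡ-+-* (suc z) n (m ∸ n) ⟨
    suc z ^ (n + (m ∸ n))           ≡⟨ cong (suc z ^_) (m+[n∸m]≡n n≤m) ⟩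
    suc z ^ m                       ≤⟨ le ⟩
    c * z ^ m                       ≡⟨ cong (λ k → c * z ^ k) (m+[n∸m]≡n n≤m) ⟨
    c * z ^ (n + (m ∸ n))           ≡⟨ cong (c *_) (^-distribˡ-+-* z n (m ∸ n)) ⟩
    c * (z ^ n * z ^ (m ∸ n))       ≡⟨ *-assoc c _ _ ⟨
    c * z ^ n * z ^ (m ∸ n)         ∎)
  where open ≤-Reasoning

-- The bound (1 + 1/(2h))^h ≤ 2 is raised to the power 16 s, and the exponent is then lowered to n.
[1+z]^n≤2^16s*z^n : ∀ h s n → 1 ≤ h → n ≤ h * (16 * s) →
                   suc (2 * h) ^ n ≤ 2 ^ (16 * s) * (2 * h) ^ n
[1+z]^n≤2^16s*z^n h s n 1≤h n≤ = ^-ratio-antitone (2 * h) (2 ^ (16 * s)) (≤-trans 1≤h (m≤m+n h _)) n≤ (begin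
  suc (2 * h) ^ (h * (16 * s))              ≡⟨ ^-*-assoc (suc (2 * h)) h (16 * s) ⟨
  (suc (2 * h) ^ h) ^ (16 * s)              ≤⟨ ^-monoˡ-≤ (16 * s) ([1+2h]^h≤2[2h]^h h) ⟩
  (2 * (2 * h) ^ h) ^ (16 * s)              ≡⟨ ^-distribʳ-* 2 ((2 * h) ^ h) (16 * s) ⟩
  2 ^ (16 * s) * ((2 * h) ^ h) ^ (16 * s)   ≡⟨ cong (2 ^ (16 * s) *_) (^-*-assoc (2 * h) h (16 * s)) ⟩
  2 ^ (16 * s) * (2 * h) ^ (h * (16 * s))   ∎)
  where open ≤-Reasoning

-- The terms are at most X/4, X/16, and so on, with sum at most X/3. In the induction the tail
-- multiplied by 4 satisfies the same hypothesis.
∑-geometric : ∀ k X (A : ℕ → ℕ) → (∀ i → i < k → 4 ^ suc i * A i ≤ X) → 3 * ∑ (upTo k) A ≤ X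
∑-geometric k X A bound = subst (λ l → 3 * sum l ≤ X) (sym (map-applyUpTo id A k)) (go k A bound)
  where
  open ≤-Reasoning
  e₁ : ∀ a s → 4 * (3 * (a + s)) ≡ 3 * (4 * 1 * a) + 3 * (4 * s)
  e₁ = solve-∀
  e₂ : ∀ p a → 4 * p * (4 * a) ≡ 4 * (4 * p) * a
  e₂ = solve-∀
  scale : ∀ k (A : ℕ → ℕ) → sum (applyUpTo (λ i → 4 * A i) k) ≡ 4 * sum (applyUpTo A k)
  scale zero    A = refl
  scale (suc k) A = trans (cong (4 * A 0 +_) (scale k (A ∘ suc)))
                          (sym (*-distribˡ-+ 4 (A 0) _))
  go : ∀ k (A : ℕ → ℕ) → (∀ i → i < k → 4 ^ suc i * A i ≤ X) → 3 * sum (applyUpTo A k) ≤ X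
  go zero    A bound = z≤n
  go (suc k) A bound = *-cancelˡ-≤ 4 (begin
    4 * (3 * (A 0 + sum (applyUpTo (A ∘ suc) k)))                ≡⟨ e₁ (A 0) _ ⟩
    3 * (4 * 1 * A 0) + 3 * (4 * sum (applyUpTo (A ∘ suc) k))
      ≤⟨ +-mono-≤ (*-monoʳ-≤ 3 (bound 0 (s≤s z≤n)))
           (subst (λ y → 3 * y ≤ X) (scale k (A ∘ suc))
             (go k (λ i → 4 * A (suc i))
               (λ i i<k → subst (_≤ X) (sym (e₂ (4 ^ i) (A (suc i)))) (bound (suc i) (s≤s i<k))))) ⟩
    3 * X + X                                                    ≡⟨ +-comm (3 * X) X ⟩
    4 * X                                                        ∎)

last-true : ∀ (P : ℕ → Set) → (∀ x → Dec (P x)) → ∀ d a → P a → ¬ P (d + a) →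
            ∃ λ x → a ≤ x × P x × ¬ P (suc x)
last-true P P? zero    a Pa ¬P = contradiction Pa ¬P
last-true P P? (suc d) a Pa ¬P with P? (suc a)
... | no  ¬P′ = a , ≤-refl , Pa , ¬P′
... | yes P′ with last-true P P? d (suc a) P′ (λ p → ¬P (subst P (+-suc d a) p))
...   | x , a<x , r = x , <⇒≤ a<x , r

-- Edge sequences and vertex subsets.

Edge : ℕ → Set
Edge n = Fin n × Fin n

-- Loops and both orientations are kept, so each coordinate of an edge sequence has exactly n²
-- choices; `graph` discards the loops.
pairs : ∀ n → List (Edge n)
pairs n = cartesianProduct (allFin n) (allFin n)

subsets : ∀ n → List (Subset n)
subsets n = words (true ∷ false ∷ []) n

∈-subsets : ∀ {n} (S : Subset n) → S ∈ˡ subsets n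
∈-subsets = ∈-words λ { true → here refl ; false → there (here refl) }

within : ∀ {n} → Subset n → Edge n → Bool
within S (u , v) = lookup S u ∧ lookup S v

span : ∀ {n M} → Subset n → Vec (Edge n) M → ℕ
span S []      = 0
span S (e ∷ w) = ⟦ within S e ⟧ + span S w

⟦∧⟧ : ∀ a b → ⟦ a ∧ b ⟧ ≡ ⟦ a ⟧ * ⟦ b ⟧
⟦∧⟧ false b = refl
⟦∧⟧ true  b = sym (+-identityʳ ⟦ b ⟧)

∑-pairs-1 : ∀ n → ∑ (pairs n) (λ _ → 1) ≡ n * n
∑-pairs-1 n = trans (∑-cartesianProductWith _,_ (allFin n) (allFin n) (λ _ → 1))
  (trans (∑-cong (allFin n) (λ _ → trans (∑-allFin-1 n) (sym (*-identityʳ n))))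
    (trans (∑-distribˡ-* (allFin n) n (λ _ → 1)) (cong (n *_) (∑-allFin-1 n))))

∑-pairs-within : ∀ {n} (S : Subset n) → ∑ (pairs n) (λ e → ⟦ within S e ⟧) ≡ ∣ S ∣ * ∣ S ∣
∑-pairs-within {n} S = begin
  ∑ (pairs n) (λ e → ⟦ within S e ⟧)
    ≡⟨ ∑-cartesianProductWith _,_ (allFin n) (allFin n) (λ e → ⟦ within S e ⟧) ⟩
  ∑ (allFin n) (λ u → ∑ (allFin n) (λ v → ⟦ lookup S u ∧ lookup S v ⟧))
    ≡⟨ ∑-cong (allFin n) (λ u → trans (∑-cong (allFin n) (λ v → ⟦∧⟧ (lookup S u) (lookup S v)))
                                       (∑-distribˡ-* (allFin n) ⟦ lookup S u ⟧ (λ v → ⟦ lookup S v ⟧))) ⟩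
  ∑ (allFin n) (λ u → ⟦ lookup S u ⟧ * ∑ (allFin n) (λ v → ⟦ lookup S v ⟧))
    ≡⟨ ∑-distribʳ-* (allFin n) _ (λ u → ⟦ lookup S u ⟧) ⟩
  ∑ (allFin n) (λ v → ⟦ lookup S v ⟧) * ∑ (allFin n) (λ v → ⟦ lookup S v ⟧)
    ≡⟨ cong₂ _*_ (∑-lookup S) (∑-lookup S) ⟩
  ∣ S ∣ * ∣ S ∣ ∎
  where open ≡-Reasoning

∑-pairs-diagonal : ∀ n → ∑ (pairs n) (λ e → ⟦ ⌊ proj₁ e Fin.≟ proj₂ e ⌋ ⟧) ≡ n
∑-pairs-diagonal n = trans
  (∑-cartesianProductWith _,_ (allFin n) (allFin n) (λ e → ⟦ ⌊ proj₁ e Fin.≟ proj₂ e ⌋ ⟧))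
  (trans (∑-cong (allFin n) ∑-≟) (∑-allFin-1 n))

-- Dense small sets

-- Turns an exponential moment of `span` into a product over the edges, the form that `∑-words-∏`
-- evaluates.
∏-span : ∀ {n M} y (S : Subset n) (w : Vec (Edge n) M) →
         ∏ (λ e → y ^ ⟦ within S e ⟧) w ≡ y ^ span S w
∏-span y S []      = refl
∏-span y S (e ∷ w) = trans (cong (y ^ ⟦ within S e ⟧ *_) (∏-span y S w))
                           (sym (^-distribˡ-+-* y ⟦ within S e ⟧ (span S w)))

∑-pairs-^within : ∀ {n} z (S : Subset n) →
                  ∑ (pairs n) (λ e → z ^ ⟦ within S e ⟧) ≤ n * n + z * (∣ S ∣ * ∣ S ∣)
∑-pairs-^within {n} z S = begin
  ∑ (pairs n) (λ e → z ^ ⟦ within S e ⟧)             ≤⟨ ∑-mono (pairs n) (λ e → bound (within S e)) ⟩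
  ∑ (pairs n) (λ e → 1 + z * ⟦ within S e ⟧)         ≡⟨ ∑-distrib-+ (pairs n) (λ _ → 1) (λ e → z * ⟦ within S e ⟧) ⟩
  ∑ (pairs n) (λ _ → 1) + ∑ (pairs n) (λ e → z * ⟦ within S e ⟧)
    ≡⟨ cong₂ _+_ (∑-pairs-1 n) (trans (∑-distribˡ-* (pairs n) z (λ e → ⟦ within S e ⟧))
                                      (cong (z *_) (∑-pairs-within S))) ⟩
  n * n + z * (∣ S ∣ * ∣ S ∣) ∎
  where
  open ≤-Reasoning
  bound : ∀ b → z ^ ⟦ b ⟧ ≤ 1 + z * ⟦ b ⟧
  bound false = m≤m+n 1 (z * 0)
  bound true  = n≤1+n (z * 1)

denseIs : ∀ {n M} → ℕ → Subset n → Vec (Edge n) M → ℕ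
denseIs s S w = ⟦ ⌊ 4 * s <? 3 * span S w ⌋ ⟧

denseIs≡0 : ∀ {n M} s (S : Subset n) (w : Vec (Edge n) M) → denseIs s S w ≡ 0 → 3 * span S w ≤ 4 * s
denseIs≡0 s S w eq with 4 * s <? 3 * span S w
... | no ≮ = ≮⇒≥ ≮

sizeIs : ∀ {n} → ℕ → Subset n → ℕ
sizeIs s S = ⟦ ⌊ ∣ S ∣ ≟ s ⌋ ⟧

-- Each edge inside a fixed set of size s gets weight z = y³. By `sparse`, the mean weight of an
-- edge is at most 1 + z s²/n² ≤ 1 + 1/z, and `ratio` bounds the n-th power of 1 + 1/z by K; hence n
-- D independent edges have mean weight at most K^D.
module DenseCount (n D y s K : ℕ) (1≤y : 1 ≤ y) (sparse : y ^ 3 * s ≤ n)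
                  (ratio : suc (y ^ 3) ^ n ≤ K * (y ^ 3) ^ n) where

  private
    z = y ^ 3
    X = (n * n) ^ (n * D)
    Ω = words (pairs n) (n * D)
    instance
      nzy : NonZero y
      nzy = >-nonZero 1≤y
    open ≤-Reasoning

  -- Markov's inequality for y^{3 span S}.
  markov : ∀ (S : Subset n) → ∑ Ω (denseIs s S) * y ^ (4 * s) ≤ ∑ (pairs n) (λ e → z ^ ⟦ within S e ⟧) ^ (n * D)
  markov S = begin
    ∑ Ω (denseIs s S) * y ^ (4 * s)                ≡⟨ ∑-distribʳ-* Ω (y ^ (4 * s)) (denseIs s S) ⟨
    ∑ Ω (λ w → denseIs s S w * y ^ (4 * s))        ≤⟨ ∑-mono Ω bound ⟩
    ∑ Ω (∏ (λ e → z ^ ⟦ within S e ⟧))            ≡⟨ ∑-words-∏ (pairs n) _ (n * D) ⟩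
    ∑ (pairs n) (λ e → z ^ ⟦ within S e ⟧) ^ (n * D) ∎
    where
    bound : ∀ w → denseIs s S w * y ^ (4 * s) ≤ ∏ (λ e → z ^ ⟦ within S e ⟧) w
    bound w with 4 * s <? 3 * span S w
    ... | no  _ = z≤n
    ... | yes d = begin
      1 * y ^ (4 * s)                     ≡⟨ *-identityˡ _ ⟩
      y ^ (4 * s)                         ≤⟨ ^-monoʳ-≤ y (<⇒≤ d) ⟩
      y ^ (3 * span S w)                  ≡⟨ ^-*-assoc y 3 (span S w) ⟨
      z ^ span S w                        ≡⟨ ∏-span z S w ⟨
      ∏ (λ e → z ^ ⟦ within S e ⟧) w      ∎

  count-for-set : ∀ (S : Subset n) → ∣ S ∣ ≡ s → ∑ Ω (denseIs s S) * y ^ (4 * s) ≤ X * K ^ D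
  count-for-set S refl = *-cancelʳ-≤ _ _ (z ^ (n * D)) {{m^n≢0 z (n * D) {{m^n≢0 y 3}}}} (begin
    ∑ Ω (denseIs s S) * y ^ (4 * s) * z ^ (n * D)                  ≤⟨ *-monoˡ-≤ (z ^ (n * D)) (markov S) ⟩
    ∑ (pairs n) (λ e → z ^ ⟦ within S e ⟧) ^ (n * D) * z ^ (n * D) ≤⟨ *-monoˡ-≤ (z ^ (n * D)) (^-monoˡ-≤ (n * D) (∑-pairs-^within z S)) ⟩
    (n * n + z * (s * s)) ^ (n * D) * z ^ (n * D)                 ≡⟨ ^-distribʳ-* (n * n + z * (s * s)) z (n * D) ⟨
    ((n * n + z * (s * s)) * z) ^ (n * D)                         ≤⟨ ^-monoˡ-≤ (n * D) base ⟩
    (n * n * suc z) ^ (n * D)                                     ≡⟨ ^-distribʳ-* (n * n) (suc z) (n * D) ⟩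
    X * suc z ^ (n * D)                                           ≡⟨ cong (X *_) (^-*-assoc (suc z) n D) ⟨
    X * (suc z ^ n) ^ D                                           ≤⟨ *-monoʳ-≤ X (^-monoˡ-≤ D ratio) ⟩
    X * (K * z ^ n) ^ D                                           ≡⟨ cong (X *_) (^-distribʳ-* K (z ^ n) D) ⟩
    X * (K ^ D * (z ^ n) ^ D)                                     ≡⟨ cong (λ p → X * (K ^ D * p)) (^-*-assoc z n D) ⟩
    X * (K ^ D * z ^ (n * D))                                     ≡⟨ *-assoc X _ _ ⟨
    X * K ^ D * z ^ (n * D)                                       ∎)
    where
    e₁ : ∀ n z s → (n * n + z * (s * s)) * z ≡ n * n * z + z * s * (z * s)
    e₁ = solve-∀
    e₂ : ∀ n z → n * n * z + n * n ≡ n * n * (1 + z)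
    e₂ = solve-∀
    base : (n * n + z * (s * s)) * z ≤ n * n * suc z
    base = begin
      (n * n + z * (s * s)) * z          ≡⟨ e₁ n z s ⟩
      n * n * z + z * s * (z * s)        ≤⟨ +-monoʳ-≤ (n * n * z) (*-mono-≤ sparse sparse) ⟩
      n * n * z + n * n                  ≡⟨ e₂ n z ⟩
      n * n * suc z                      ∎

  -- Give each member weight 1 and each non-member weight z. A set of size s then weighs z^(n - s),
  -- while all subsets together weigh (1 + z)^n ≤ K z^n.
  number-of-sets : ∑ (subsets n) (sizeIs s) ≤ K * z ^ s
  number-of-sets = *-cancelʳ-≤ _ _ (z ^ n) {{m^n≢0 z n {{m^n≢0 y 3}}}} (begin
    ∑ (subsets n) (sizeIs s) * z ^ n                         ≡⟨ ∑-distribʳ-* (subsets n) (z ^ n) (sizeIs s) ⟨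
    ∑ (subsets n) (λ S → sizeIs s S * z ^ n)               ≤⟨ ∑-mono (subsets n) bound ⟩
    ∑ (subsets n) (λ S → z ^ s * ∏ t S)                 ≡⟨ ∑-distribˡ-* (subsets n) (z ^ s) (∏ t) ⟩
    z ^ s * ∑ (subsets n) (∏ t)                         ≡⟨ cong (z ^ s *_) (∑-words-∏ (true ∷ false ∷ []) t n) ⟩
    z ^ s * (1 + (z + 0)) ^ n                           ≡⟨ cong (λ k → z ^ s * suc k ^ n) (+-identityʳ z) ⟩
    z ^ s * suc z ^ n                                   ≤⟨ *-monoʳ-≤ (z ^ s) ratio ⟩
    z ^ s * (K * z ^ n)                                 ≡⟨ e₁ (z ^ s) K (z ^ n) ⟩
    K * z ^ s * z ^ n                                   ∎)
    where
    e₁ : ∀ a b c → a * (b * c) ≡ b * a * c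
    e₁ = solve-∀
    e₂ : ∀ a b c → a * (b * c) ≡ b * (a * c)
    e₂ = solve-∀
    t : Bool → ℕ
    t true  = 1
    t false = z
    weight : ∀ {m} (S : Subset m) → z ^ m ≡ z ^ ∣ S ∣ * ∏ t S
    weight []          = refl
    weight (true  ∷ S) = trans (cong (z *_) (weight S))
      (trans (sym (*-assoc z (z ^ ∣ S ∣) (∏ t S))) (cong (z * z ^ ∣ S ∣ *_) (sym (*-identityˡ (∏ t S)))))
    weight (false ∷ S) = trans (cong (z *_) (weight S)) (e₂ z (z ^ ∣ S ∣) (∏ t S))
    bound : ∀ S → sizeIs s S * z ^ n ≤ z ^ s * ∏ t S
    bound S with ∣ S ∣ ≟ s
    ... | no  _    = z≤n
    ... | yes size = ≤-reflexive (trans (*-identityˡ (z ^ n)) (trans (weight S) (cong (λ k → z ^ k * ∏ t S) size)))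

  -- Union bound over the sets of size s: their number costs y^(3s) out of the y^(4s) gained from
  -- Markov's inequality. The excess of the density 4/3 over 1 is what leaves y^s.
  count : ∑ (subsets n) (λ S → sizeIs s S * ∑ Ω (denseIs s S)) * y ^ s ≤ X * K ^ suc D
  count = *-cancelʳ-≤ _ _ (z ^ s) {{m^n≢0 z s {{m^n≢0 y 3}}}} (begin
    A * y ^ s * z ^ s
      ≡⟨ *-assoc A (y ^ s) (z ^ s) ⟩
    A * (y ^ s * z ^ s)
      ≡⟨ cong (A *_) y⁴ ⟩
    A * y ^ (4 * s)
      ≡⟨ ∑-distribʳ-* (subsets n) (y ^ (4 * s)) _ ⟨
    ∑ (subsets n) (λ S → sizeIs s S * ∑ Ω (denseIs s S) * y ^ (4 * s))
      ≤⟨ ∑-mono (subsets n) bound ⟩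
    ∑ (subsets n) (λ S → sizeIs s S * (X * K ^ D))
      ≡⟨ ∑-distribʳ-* (subsets n) (X * K ^ D) (sizeIs s) ⟩
    ∑ (subsets n) (sizeIs s) * (X * K ^ D)
      ≤⟨ *-monoˡ-≤ (X * K ^ D) number-of-sets ⟩
    K * z ^ s * (X * K ^ D)
      ≡⟨ e₁ K (z ^ s) X (K ^ D) ⟩
    X * K ^ suc D * z ^ s ∎)
    where
    A = ∑ (subsets n) (λ S → sizeIs s S * ∑ Ω (denseIs s S))
    e₁ : ∀ k z x l → k * z * (x * l) ≡ x * (k * l) * z
    e₁ = solve-∀
    y⁴ : y ^ s * z ^ s ≡ y ^ (4 * s)
    y⁴ = trans (cong (y ^ s *_) (^-*-assoc y 3 s)) (sym (^-distribˡ-+-* y s (3 * s)))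
    bound : ∀ S → sizeIs s S * ∑ Ω (denseIs s S) * y ^ (4 * s) ≤ sizeIs s S * (X * K ^ D)
    bound S with ∣ S ∣ ≟ s
    ... | no  _    = z≤n
    ... | yes size = subst (λ c → c * y ^ (4 * s) ≤ 1 * (X * K ^ D)) (sym (*-identityˡ (∑ Ω (denseIs s S))))
                       (≤-trans (count-for-set S size) (≤-reflexive (sym (*-identityˡ _))))

-- With K = 2^{16 s}, summing DenseCount.count over s gives a geometric series of ratio 1/4 once
-- y^s ≥ 4^s K^{1+D}.
threshold : ℕ → ℕ
threshold D = 4 * 2 ^ (16 * suc D)

-- Take y = 2x with x maximal subject to 8 x³ s ≤ n: then n ≤ 8 y³ s, so (1 + y⁻³)^n ≤ K.
dense-count : ∀ n D s → 1 ≤ s → 8 * threshold D ^ 3 * s ≤ n →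
  4 ^ s * ∑ (subsets n) (λ S → sizeIs s S * ∑ (words (pairs n) (n * D)) (denseIs s S)) ≤ (n * n) ^ (n * D)
dense-count n D s 1≤s small
  with last-true (λ x → 8 * x ^ 3 * s ≤ n) (λ x → 8 * x ^ 3 * s ≤? n) (suc n) (threshold D) small too-big
  where
  open ≤-Reasoning
  too-big : ¬ 8 * (suc n + threshold D) ^ 3 * s ≤ n
  too-big le = <⇒≱ (begin-strict
    n                                        <⟨ n<1+n n ⟩
    suc n                                    ≤⟨ m≤m+n (suc n) (threshold D) ⟩
    suc n + threshold D                      ≡⟨ *-identityʳ _ ⟨
    (suc n + threshold D) * 1                ≤⟨ *-monoʳ-≤ (suc n + threshold D) (m^n>0 (suc n + threshold D) 2) ⟩
    (suc n + threshold D) ^ 3                ≤⟨ m≤m+n _ _ ⟩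
    8 * (suc n + threshold D) ^ 3            ≡⟨ *-identityʳ _ ⟨
    8 * (suc n + threshold D) ^ 3 * 1        ≤⟨ *-monoʳ-≤ (8 * (suc n + threshold D) ^ 3) 1≤s ⟩
    8 * (suc n + threshold D) ^ 3 * s        ∎) le
... | x , L≤x , fits , ¬fits = *-cancelˡ-≤ (K ^ suc D) {{m^n≢0 K (suc D) {{m^n≢0 2 (16 * s)}}}} (begin
    K ^ suc D * (4 ^ s * A)          ≡⟨ *-assoc (K ^ suc D) (4 ^ s) A ⟨
    K ^ suc D * 4 ^ s * A            ≤⟨ *-monoˡ-≤ A powers ⟩
    y ^ s * A                        ≡⟨ *-comm (y ^ s) A ⟩
    A * y ^ s                        ≤⟨ DenseCount.count n D y s K 1≤y fits′ ratio ⟩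
    X * K ^ suc D                    ≡⟨ *-comm X _ ⟩
    K ^ suc D * X                    ∎)
  where
  open ≤-Reasoning
  K = 2 ^ (16 * s)
  X = (n * n) ^ (n * D)
  A = ∑ (subsets n) (λ S → sizeIs s S * ∑ (words (pairs n) (n * D)) (denseIs s S))
  y = 2 * x
  h = 4 * x ^ 3
  1≤x : 1 ≤ x
  1≤x = ≤-trans (≤-trans (m^n>0 2 (16 * suc D)) (m≤m+n _ _)) L≤x
  1≤y : 1 ≤ y
  1≤y = ≤-trans 1≤x (m≤m+n x _)
  y³≡ : y ^ 3 ≡ 8 * x ^ 3
  y³≡ = ^-distribʳ-* 2 x 3
  y³≡2h : y ^ 3 ≡ 2 * h
  y³≡2h = trans y³≡ (*-assoc 2 4 (x ^ 3))
  fits′ : y ^ 3 * s ≤ n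
  fits′ = subst (λ z → z * s ≤ n) (sym y³≡) fits
  e₁ : ∀ p s → 8 * (8 * p) * s ≡ 4 * p * (16 * s)
  e₁ = solve-∀
  n≤ : n ≤ h * (16 * s)
  n≤ = begin
    n                         ≤⟨ <⇒≤ (≰⇒> ¬fits) ⟩
    -- Since x ≥ 1, the step from x to x + 1 stays below 2x = y, so maximality of x loses only a
    -- constant factor.
    8 * suc x ^ 3 * s         ≤⟨ *-monoˡ-≤ s (*-monoʳ-≤ 8 (^-monoˡ-≤ 3 (+-mono-≤ 1≤x (m≤m+n x 0)))) ⟩
    8 * y ^ 3 * s             ≡⟨ cong (λ z → 8 * z * s) y³≡ ⟩
    8 * (8 * x ^ 3) * s       ≡⟨ e₁ (x ^ 3) s ⟩
    h * (16 * s)              ∎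
  ratio : suc (y ^ 3) ^ n ≤ K * (y ^ 3) ^ n
  ratio = subst (λ z → suc z ^ n ≤ K * z ^ n) (sym y³≡2h)
    ([1+z]^n≤2^16s*z^n h s n (≤-trans (m^n>0 x {{>-nonZero 1≤x}} 3) (m≤m+n _ _)) n≤)
  e₂ : ∀ s d → 16 * s * d ≡ 16 * d * s
  e₂ = solve-∀
  powers : K ^ suc D * 4 ^ s ≤ y ^ s
  powers = begin
    K ^ suc D * 4 ^ s                     ≡⟨ cong (_* 4 ^ s) (^-*-assoc 2 (16 * s) (suc D)) ⟩
    2 ^ (16 * s * suc D) * 4 ^ s          ≡⟨ cong (λ m → 2 ^ m * 4 ^ s) (e₂ s (suc D)) ⟩
    2 ^ (16 * suc D * s) * 4 ^ s          ≡⟨ cong (_* 4 ^ s) (^-*-assoc 2 (16 * suc D) s) ⟨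
    (2 ^ (16 * suc D)) ^ s * 4 ^ s        ≡⟨ *-comm _ (4 ^ s) ⟩
    4 ^ s * (2 ^ (16 * suc D)) ^ s        ≡⟨ ^-distribʳ-* 4 (2 ^ (16 * suc D)) s ⟨
    threshold D ^ s                       ≤⟨ ^-monoˡ-≤ s (≤-trans L≤x (m≤m+n x _)) ⟩
    y ^ s                                 ∎

-- Large sets

-- An upper bound for the indicator of a pair being a loop or leaving S; it has value 2 on some
-- loops, which keeps its sum over all pairs simple.
chord-free : ∀ {n} → Subset n → Edge n → ℕ
chord-free S e = ⟦ not (within S e) ⟧ + ⟦ ⌊ proj₁ e Fin.≟ proj₂ e ⌋ ⟧

∑-chord-free : ∀ {n} (S : Subset n) → ∑ (pairs n) (chord-free S) + ∣ S ∣ * ∣ S ∣ ≡ n * n + n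
∑-chord-free {n} S = begin
  ∑ P (chord-free S) + ∣ S ∣ * ∣ S ∣          ≡⟨ cong₂ _+_ (∑-distrib-+ P f g) (sym (∑-pairs-within S)) ⟩
  ∑ P f + ∑ P g + ∑ P h                       ≡⟨ e₁ (∑ P f) (∑ P g) (∑ P h) ⟩
  ∑ P f + ∑ P h + ∑ P g                       ≡⟨ cong₂ _+_ (∑-distrib-+ P f h) (sym (∑-pairs-diagonal n)) ⟨
  ∑ P (λ e → f e + h e) + n                   ≡⟨ cong (_+ n) (∑-cong P (λ e → complement (within S e))) ⟩
  ∑ P (λ _ → 1) + n                           ≡⟨ cong (_+ n) (∑-pairs-1 n) ⟩
  n * n + n                                   ∎
  where
  open ≡-Reasoning
  P = pairs n
  f h g : Edge n → ℕ
  f e = ⟦ not (within S e) ⟧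
  h e = ⟦ within S e ⟧
  g e = ⟦ ⌊ proj₁ e Fin.≟ proj₂ e ⌋ ⟧
  e₁ : ∀ a b c → a + b + c ≡ a + c + b
  e₁ = solve-∀
  complement : ∀ b → ⟦ not b ⟧ + ⟦ b ⟧ ≡ 1
  complement false = refl
  complement true  = refl

∏≡0⇒∃≡0 : ∀ {A : Set} {m} (t : A → ℕ) (w : Vec A m) → ∏ t w ≡ 0 → ∃ λ x → x ∈ w × t x ≡ 0
∏≡0⇒∃≡0 t (x ∷ w) eq with m*n≡0⇒m≡0∨n≡0 (t x) eq
... | inj₁ tx≡0 = x , VecAny.here refl , tx≡0
... | inj₂ rest with ∏≡0⇒∃≡0 t w rest
...   | x′ , x′∈w , tx′≡0 = x′ , VecAny.there x′∈w , tx′≡0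

HasChord : ∀ {n M} → Vec (Edge n) M → Subset n → Set
HasChord w S = ∃ λ u → ∃ λ v → (u , v) ∈ w × u ∈ˢ S × v ∈ˢ S × u ≢ v

-- Contrapositively, the product is at least 1 on every sequence without a chord in S, so its sum
-- bounds the number of such sequences.
∏-chord-free≡0 : ∀ {n M} (S : Subset n) (w : Vec (Edge n) M) → ∏ (chord-free S) w ≡ 0 → HasChord w S
∏-chord-free≡0 S w eq with ∏≡0⇒∃≡0 (chord-free S) w eq
... | (u , v) , e∈w , t≡0 with lookup S u in u∈ | lookup S v in v∈ | u Fin.≟ v
...   | true | true | no u≢v = u , v , e∈w , lookup⇒[]= u S u∈ , lookup⇒[]= v S v∈ , u≢v

largeIs : ∀ {n} → ℕ → Subset n → ℕ
largeIs R S = ⟦ ⌊ R ≤? ∣ S ∣ ⌋ ⟧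

-- The ratio τ/N is at most a/(1 + a), whose a-th power is at most 1/2.
2*τ^a≤N^a : ∀ a τ N → 1 ≤ a → suc a * τ ≤ a * N → 2 * τ ^ a ≤ N ^ a
2*τ^a≤N^a a@(suc _) τ N 1≤a le = *-cancelˡ-≤ (a ^ a) {{m^n≢0 a a}} (begin
  a ^ a * (2 * τ ^ a)      ≡⟨ e₁ (a ^ a) (τ ^ a) ⟩
  2 * a ^ a * τ ^ a        ≤⟨ *-monoˡ-≤ (τ ^ a) (2*a^a≤[1+a]^a a 1≤a) ⟩
  suc a ^ a * τ ^ a        ≡⟨ ^-distribʳ-* (suc a) τ a ⟨
  (suc a * τ) ^ a          ≤⟨ ^-monoˡ-≤ a le ⟩
  (a * N) ^ a              ≡⟨ ^-distribʳ-* a N a ⟩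
  a ^ a * N ^ a            ∎)
  where
  open ≤-Reasoning
  e₁ : ∀ p t → p * (2 * t) ≡ 2 * p * t
  e₁ = solve-∀

-- A set of at least R = n/q vertices contains a fraction 1/q² of all pairs. As 2q ≤ R, the
-- correction for loops uses up at most half of it, so `chord-free` has mean at most 1 - 1/(2q²) =
-- a/(1 + a). Every a edges halve the product; 2 a n edges give 4^(-n), of which one factor 2^(-n)
-- pays for the union bound over all subsets.
module LargeCount (q R a : ℕ) (1≤a : 1 ≤ a) (1+a≡2q² : suc a ≡ 2 * (q * q)) (2q≤R : 2 * q ≤ R) where

  private
    n = q * R
    D = 2 * a
    X = (n * n) ^ (n * D)
    Ω = words (pairs n) (n * D)
    open ≤-Reasoning

  few-chord-free : ∀ (S : Subset n) → R ≤ ∣ S ∣ → suc a * ∑ (pairs n) (chord-free S) ≤ a * (n * n)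
  few-chord-free S R≤∣S∣ = +-cancelʳ-≤ (n * n) _ _ (begin
    suc a * τ + n * n                           ≡⟨ cong (λ b → b * τ + n * n) 1+a≡2q² ⟩
    2 * (q * q) * τ + n * n                     ≡⟨ e₁ q R τ ⟩
    q * q * (2 * τ + R * R)                     ≤⟨ *-monoʳ-≤ (q * q) core ⟩
    q * q * (2 * (n * n))                       ≡⟨ e₂ q (n * n) ⟩
    2 * (q * q) * (n * n)                       ≡⟨ cong (_* (n * n)) 1+a≡2q² ⟨
    suc a * (n * n)                             ≡⟨ +-comm (n * n) _ ⟩
    a * (n * n) + n * n                         ∎)
    where
    τ = ∑ (pairs n) (chord-free S)
    e₁ : ∀ q R t → 2 * (q * q) * t + q * R * (q * R) ≡ q * q * (2 * t + R * R)
    e₁ = solve-∀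
    e₂ : ∀ q N → q * q * (2 * N) ≡ 2 * (q * q) * N
    e₂ = solve-∀
    e₃ : ∀ t r → 2 * t + r + r ≡ 2 * (t + r)
    e₃ = solve-∀
    e₄ : ∀ N q R → 2 * (N + q * R) ≡ 2 * N + 2 * q * R
    e₄ = solve-∀
    core : 2 * τ + R * R ≤ 2 * (n * n)
    core = +-cancelʳ-≤ (R * R) _ _ (begin
      2 * τ + R * R + R * R                ≡⟨ e₃ τ (R * R) ⟩
      2 * (τ + R * R)                      ≤⟨ *-monoʳ-≤ 2 (+-monoʳ-≤ τ (*-mono-≤ R≤∣S∣ R≤∣S∣)) ⟩
      2 * (τ + ∣ S ∣ * ∣ S ∣)              ≡⟨ cong (2 *_) (∑-chord-free S) ⟩
      2 * (n * n + n)                      ≡⟨ e₄ (n * n) q R ⟩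
      2 * (n * n) + 2 * q * R              ≤⟨ +-monoʳ-≤ (2 * (n * n)) (*-monoˡ-≤ R 2q≤R) ⟩
      2 * (n * n) + R * R                  ∎)

  count-for-set : ∀ (S : Subset n) → R ≤ ∣ S ∣ → 2 ^ n * (2 ^ n * ∑ Ω (∏ (chord-free S))) ≤ X
  count-for-set S R≤∣S∣ = begin
    2 ^ n * (2 ^ n * ∑ Ω (∏ (chord-free S)))          ≡⟨ cong (λ c → 2 ^ n * (2 ^ n * c)) (∑-words-∏ (pairs n) (chord-free S) (n * D)) ⟩
    2 ^ n * (2 ^ n * τ ^ (n * D))                     ≡⟨ *-assoc (2 ^ n) (2 ^ n) _ ⟨
    2 ^ n * 2 ^ n * τ ^ (n * D)                       ≡⟨ cong₂ _*_ (^-distribˡ-+-* 2 n n) (trans (^-*-assoc τ a (n + n)) (cong (τ ^_) (e₁ a n))) ⟨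
    2 ^ (n + n) * (τ ^ a) ^ (n + n)                   ≡⟨ ^-distribʳ-* 2 (τ ^ a) (n + n) ⟨
    (2 * τ ^ a) ^ (n + n)                             ≤⟨ ^-monoˡ-≤ (n + n) (2*τ^a≤N^a a τ (n * n) 1≤a (few-chord-free S R≤∣S∣)) ⟩
    ((n * n) ^ a) ^ (n + n)                           ≡⟨ trans (^-*-assoc (n * n) a (n + n)) (cong ((n * n) ^_) (e₁ a n)) ⟩
    X                                                 ∎
    where
    τ = ∑ (pairs n) (chord-free S)
    e₁ : ∀ a n → a * (n + n) ≡ n * (2 * a)
    e₁ = solve-∀

  count : 2 ^ n * ∑ (subsets n) (λ S → largeIs R S * ∑ Ω (∏ (chord-free S))) ≤ X
  count = *-cancelˡ-≤ (2 ^ n) {{m^n≢0 2 n}} (begin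
    2 ^ n * (2 ^ n * ∑ (subsets n) W)                  ≡⟨ cong (2 ^ n *_) (∑-distribˡ-* (subsets n) (2 ^ n) W) ⟨
    2 ^ n * ∑ (subsets n) (λ S → 2 ^ n * W S)          ≡⟨ ∑-distribˡ-* (subsets n) (2 ^ n) _ ⟨
    ∑ (subsets n) (λ S → 2 ^ n * (2 ^ n * W S))        ≤⟨ ∑-mono (subsets n) bound ⟩
    ∑ (subsets n) (λ S → X * 1)                        ≡⟨ ∑-distribˡ-* (subsets n) X (λ _ → 1) ⟩
    X * ∑ (subsets n) (λ _ → 1)                        ≡⟨ cong (X *_) number-of-subsets ⟩
    X * 2 ^ n                                          ≡⟨ *-comm X (2 ^ n) ⟩
    2 ^ n * X                                          ∎)
    where
    W : Subset n → ℕ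
    W S = largeIs R S * ∑ Ω (∏ (chord-free S))
    number-of-subsets : ∑ (subsets n) (λ _ → 1) ≡ 2 ^ n
    number-of-subsets = trans (∑-cong (subsets n) (λ S → sym (∏-1 S)))
                              (∑-words-∏ (true ∷ false ∷ []) (λ _ → 1) n)
    bound : ∀ S → 2 ^ n * (2 ^ n * W S) ≤ X * 1
    bound S with R ≤? ∣ S ∣
    ... | no  _ = ≤-trans (≤-reflexive (trans (cong (2 ^ n *_) (*-zeroʳ (2 ^ n))) (*-zeroʳ (2 ^ n)))) z≤n
    ... | yes R≤∣S∣ = subst (λ c → 2 ^ n * (2 ^ n * c) ≤ X * 1) (sym (*-identityˡ _))
                       (≤-trans (count-for-set S R≤∣S∣) (≤-reflexive (sym (*-identityʳ X))))

-- A sequence with both properties.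

largeWeight denseWeight : ∀ {n M} → ℕ → Vec (Edge n) M → ℕ
largeWeight R w = ∑ (subsets _) (λ S → largeIs R S * ∏ (chord-free S) w)
-- The index i stands for sets of size i + 1, so the empty set is left out.
denseWeight σ w = ∑ (upTo σ) (λ i → ∑ (subsets _) (λ S → sizeIs (suc i) S * denseIs (suc i) S w))

largeWeight≡0 : ∀ {n M} R (w : Vec (Edge n) M) → largeWeight R w ≡ 0 → ∀ S → R ≤ ∣ S ∣ → HasChord w S
largeWeight≡0 R w W≡0 S R≤∣S∣ = ∏-chord-free≡0 S w (drop (∑≡0⇒≡0 W≡0 (∈-subsets S)))
  where
  drop : largeIs R S * ∏ (chord-free S) w ≡ 0 → ∏ (chord-free S) w ≡ 0
  drop eq with R ≤? ∣ S ∣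
  ... | yes _ = trans (sym (*-identityˡ _)) eq
  ... | no  ≰ = contradiction R≤∣S∣ ≰

denseWeight≡0 : ∀ {n M} σ (w : Vec (Edge n) M) → denseWeight σ w ≡ 0 →
                ∀ S → 1 ≤ ∣ S ∣ → ∣ S ∣ ≤ σ → 3 * span S w ≤ 4 * ∣ S ∣
denseWeight≡0 σ w W≡0 S 1≤∣S∣ ∣S∣≤σ = go ∣ S ∣ refl 1≤∣S∣ ∣S∣≤σ
  where
  drop : ∀ s → ∣ S ∣ ≡ s → sizeIs s S * denseIs s S w ≡ 0 → denseIs s S w ≡ 0
  drop s size eq with ∣ S ∣ ≟ s
  ... | yes _ = trans (sym (*-identityˡ _)) eq
  ... | no  ≢ = contradiction size ≢
  go : ∀ s → ∣ S ∣ ≡ s → 1 ≤ s → s ≤ σ → 3 * span S w ≤ 4 * s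
  go (suc i) size _ i<σ =
    denseIs≡0 (suc i) S w (drop (suc i) size (∑≡0⇒≡0 (∑≡0⇒≡0 W≡0 (∈-upTo⁺ i<σ)) (∈-subsets S)))

-- With X the number of sequences, the two kinds of violation have total weight at most X/4 and X/3.
-- Since 1/4 + 1/3 < 1, some sequence has weight below 1, hence 0, and violates neither property.
sparse-graph : ∀ q R a σ → 1 ≤ a → suc a ≡ 2 * (q * q) → 2 * q ≤ R → 2 ≤ q * R →
  8 * threshold (2 * a) ^ 3 * σ ≤ q * R →
  ∃ λ (w : Vec (Edge (q * R)) (q * R * (2 * a))) →
    (∀ S → 1 ≤ ∣ S ∣ → ∣ S ∣ ≤ σ → 3 * span S w ≤ 4 * ∣ S ∣) × (∀ S → R ≤ ∣ S ∣ → HasChord w S)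
sparse-graph q R a σ 1≤a 1+a≡2q² 2q≤R 2≤n small =
  let w , lt = chosen
      W≡0 = n<1⇒n≡0 lt
  in w , denseWeight≡0 σ w (m+n≡0⇒n≡0 (largeWeight R w) W≡0)
       , largeWeight≡0 R w (m+n≡0⇒m≡0 (largeWeight R w) W≡0)
  where
  open ≤-Reasoning
  n = q * R
  D = 2 * a
  X = (n * n) ^ (n * D)
  Ω = words (pairs n) (n * D)
  open LargeCount q R a 1≤a 1+a≡2q² 2q≤R using (count)
  W₁ W₂ : Vec (Edge n) (n * D) → ℕ
  W₁ = largeWeight R
  W₂ = denseWeight σ

  exchange : ∀ (c : Subset n → ℕ) (f : Subset n → Vec (Edge n) (n * D) → ℕ) →
    ∑ Ω (λ w → ∑ (subsets n) (λ S → c S * f S w)) ≡ ∑ (subsets n) (λ S → c S * ∑ Ω (f S))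
  exchange c f = trans (∑-swap Ω (subsets n) (λ w S → c S * f S w))
                       (∑-cong (subsets n) (λ S → ∑-distribˡ-* Ω (c S) (f S)))

  4*∑W₁≤X : 4 * ∑ Ω W₁ ≤ X
  4*∑W₁≤X = begin
    4 * ∑ Ω W₁      ≤⟨ *-monoˡ-≤ (∑ Ω W₁) (^-monoʳ-≤ 2 2≤n) ⟩
    2 ^ n * ∑ Ω W₁  ≡⟨ cong (2 ^ n *_) (exchange (largeIs R) (λ S → ∏ (chord-free S))) ⟩
    2 ^ n * ∑ (subsets n) (λ S → largeIs R S * ∑ Ω (∏ (chord-free S))) ≤⟨ count ⟩
    X               ∎

  3*∑W₂≤X : 3 * ∑ Ω W₂ ≤ X
  3*∑W₂≤X = subst (λ t → 3 * t ≤ X) (sym (∑-swap Ω (upTo σ) _))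
    (∑-geometric σ X _ λ i i<σ →
      subst (λ t → 4 ^ suc i * t ≤ X) (sym (exchange (sizeIs (suc i)) (denseIs (suc i))))
        (dense-count n D (suc i) (s≤s z≤n)
          (≤-trans (*-monoʳ-≤ (8 * threshold D ^ 3) i<σ) small)))

  0<X : 0 < X
  0<X = m^n>0 (n * n) {{>-nonZero (*-mono-≤ 1≤n 1≤n)}} (n * D)
    where
    1≤n : 1 ≤ n
    1≤n = ≤-trans (s≤s z≤n) 2≤n

  e₁ : ∀ a b → 12 * (a + b) ≡ 3 * (4 * a) + 4 * (3 * b)
  e₁ = solve-∀
  e₂ : ∀ x → 3 * x + 4 * x + 5 * x ≡ 12 * x
  e₂ = solve-∀

  ∑W<X : ∑ Ω (λ w → W₁ w + W₂ w) < X
  ∑W<X = *-cancelˡ-< 12 _ _ (begin-strict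
    12 * ∑ Ω (λ w → W₁ w + W₂ w)             ≡⟨ cong (12 *_) (∑-distrib-+ Ω W₁ W₂) ⟩
    12 * (∑ Ω W₁ + ∑ Ω W₂)                   ≡⟨ e₁ (∑ Ω W₁) (∑ Ω W₂) ⟩
    3 * (4 * ∑ Ω W₁) + 4 * (3 * ∑ Ω W₂)      ≤⟨ +-mono-≤ (*-monoʳ-≤ 3 4*∑W₁≤X) (*-monoʳ-≤ 4 3*∑W₂≤X) ⟩
    3 * X + 4 * X                            <⟨ m<m+n (3 * X + 4 * X) (*-mono-≤ {1} {5} (s≤s z≤n) 0<X) ⟩
    3 * X + 4 * X + 5 * X                    ≡⟨ e₂ X ⟩
    12 * X                                   ∎)

  ∑1≡X : ∑ Ω (λ _ → 1) ≡ X
  ∑1≡X = trans (∑-cong Ω (λ w → sym (∏-1 w)))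
    (trans (∑-words-∏ (pairs n) (λ _ → 1) (n * D)) (cong (_^ (n * D)) (∑-pairs-1 n)))

  chosen : ∃ λ w → W₁ w + W₂ w < 1
  chosen = ∑<⇒∃< Ω (subst (∑ Ω (λ w → W₁ w + W₂ w) <_) (sym ∑1≡X) ∑W<X)

-- The graph of an edge sequence.

edge? : ∀ {n M} (w : Vec (Edge n) M) (u v : Fin n) → Dec ((u , v) ∈ w × u ≢ v)
edge? w u v = DecVecMembership._∈?_ (Prod.≡-dec Fin._≟_ Fin._≟_) (u , v) w ×-dec ¬? (u Fin.≟ v)

-- Loops are dropped because they would exclude every colouring. The relation keeps the orientation
-- of the pairs, which is harmless since `KEdge` is symmetric.
graph : ∀ {n M} → Vec (Edge n) M → Instance
graph {n} w = inst n (λ u v → ⌊ edge? w u v ⌋)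

rel⇒edge : ∀ {n M} (w : Vec (Edge n) M) u v → rel (graph w) u v ≡ true → (u , v) ∈ w × u ≢ v
rel⇒edge w u v eq with edge? w u v
... | yes e = e

edge⇒rel : ∀ {n M} (w : Vec (Edge n) M) u v → (u , v) ∈ w → u ≢ v → rel (graph w) u v ≡ true
edge⇒rel w u v e∈w u≢v with edge? w u v
... | yes _  = refl
... | no  ¬e = contradiction (e∈w , u≢v) ¬e

-- Unions of subsets.

∣p∪q∣≤∣p∣+∣q∣ : ∀ {n} (p q : Subset n) → ∣ p ∪ q ∣ ≤ ∣ p ∣ + ∣ q ∣
∣p∪q∣≤∣p∣+∣q∣ []          []          = z≤n
∣p∪q∣≤∣p∣+∣q∣ (false ∷ p) (false ∷ q) = ∣p∪q∣≤∣p∣+∣q∣ p q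
∣p∪q∣≤∣p∣+∣q∣ (false ∷ p) (true  ∷ q) = ≤-trans (s≤s (∣p∪q∣≤∣p∣+∣q∣ p q)) (≤-reflexive (sym (+-suc ∣ p ∣ ∣ q ∣)))
∣p∪q∣≤∣p∣+∣q∣ (true  ∷ p) (false ∷ q) = s≤s (∣p∪q∣≤∣p∣+∣q∣ p q)
∣p∪q∣≤∣p∣+∣q∣ (true  ∷ p) (true  ∷ q) = s≤s (≤-trans (∣p∪q∣≤∣p∣+∣q∣ p q) (+-monoʳ-≤ ∣ p ∣ (n≤1+n ∣ q ∣)))

∪-least : ∀ {n} {p q r : Subset n} → p ⊆ r → q ⊆ r → p ∪ q ⊆ r
∪-least {p = p} {q} p⊆r q⊆r x∈ = [ p⊆r , q⊆r ]′ (x∈p∪q⁻ p q x∈)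

∪-mono-⊆ : ∀ {n} {p q r s : Subset n} → p ⊆ r → q ⊆ s → p ∪ q ⊆ r ∪ s
∪-mono-⊆ {r = r} {s} p⊆r q⊆s = ∪-least (p⊆p∪q s ∘ p⊆r) (q⊆p∪q r s ∘ q⊆s)

x∈p∪q∧x≢y⇒x∈p∪[q-y] : ∀ {n} (p q : Subset n) {x y} → x ∈ˢ p ∪ q → x ≢ y → x ∈ˢ p ∪ (q - y)
x∈p∪q∧x≢y⇒x∈p∪[q-y] p q x∈ x≢y =
  [ (λ x∈p → p⊆p∪q _ x∈p) , (λ x∈q → q⊆p∪q p _ (x∈p∧x≢y⇒x∈p-y x∈q x≢y)) ]′ (x∈p∪q⁻ p q x∈)

-- Sparse graphs and the consistency game

-- Edges count in both directions and loops count twice, so these lists only overestimate the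
-- forbidden colours and the handshake identity below is exact.
other : ∀ {n} → Subset n → Fin n → Fin n → Fin n → List (Fin n)
other S v a b = if ⌊ a Fin.≟ v ⌋ ∧ lookup S b then b ∷ [] else []

neighbours : ∀ {n M} → Subset n → Fin n → Vec (Edge n) M → List (Fin n)
neighbours S v []            = []
neighbours S v ((a , b) ∷ w) = other S v a b ++ other S v b a ++ neighbours S v w

deg : ∀ {n M} → Vec (Edge n) M → Subset n → Fin n → ℕ
deg w S v = length (neighbours S v w)

∈-other : ∀ {n} (S : Subset n) v {b} → b ∈ˢ S → b ∈ˡ other S v v b
∈-other S v b∈S with v Fin.≟ v
... | no  v≢v = contradiction refl v≢v
... | yes _ rewrite []=⇒lookup b∈S = here refl

∈-neighboursˡ : ∀ {n M} (S : Subset n) {v b} {w : Vec (Edge n) M} → (v , b) ∈ w → b ∈ˢ S → b ∈ˡ neighbours S v w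
∈-neighboursˡ S {v} (VecAny.here refl) b∈S = ∈-++⁺ˡ (∈-other S v b∈S)
∈-neighboursˡ S {v} {w = (a , b) ∷ w} (VecAny.there e) b∈S =
  ∈-++⁺ʳ (other S v a b) (∈-++⁺ʳ (other S v b a) (∈-neighboursˡ S e b∈S))

∈-neighboursʳ : ∀ {n M} (S : Subset n) {v b} {w : Vec (Edge n) M} → (b , v) ∈ w → b ∈ˢ S → b ∈ˡ neighbours S v w
∈-neighboursʳ S {v} {b} (VecAny.here refl) b∈S = ∈-++⁺ʳ (other S v b v) (∈-++⁺ˡ (∈-other S v b∈S))
∈-neighboursʳ S {v} {w = (a , b) ∷ w} (VecAny.there e) b∈S =
  ∈-++⁺ʳ (other S v a b) (∈-++⁺ʳ (other S v b a) (∈-neighboursʳ S e b∈S))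

length-other : ∀ {n} (S : Subset n) v a b → length (other S v a b) ≡ ⟦ ⌊ a Fin.≟ v ⌋ ⟧ * ⟦ lookup S b ⟧
length-other S v a b with ⌊ a Fin.≟ v ⌋ | lookup S b
... | false | _     = refl
... | true  | false = refl
... | true  | true  = refl

deg-∷ : ∀ {n M} (S : Subset n) v a b (w : Vec (Edge n) M) → deg ((a , b) ∷ w) S v ≡
        ⟦ ⌊ a Fin.≟ v ⌋ ⟧ * ⟦ lookup S b ⟧ + (⟦ ⌊ b Fin.≟ v ⌋ ⟧ * ⟦ lookup S a ⟧ + deg w S v)
deg-∷ S v a b w = trans (length-++ (other S v a b))
  (cong₂ _+_ (length-other S v a b)
    (trans (length-++ (other S v b a)) (cong (_+ deg w S v) (length-other S v b a))))

⊆⇒⟦lookup⟧≤ : ∀ {n} {S T : Subset n} → S ⊆ T → ∀ v → ⟦ lookup S v ⟧ ≤ ⟦ lookup T v ⟧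
⊆⇒⟦lookup⟧≤ {S = S} {T} S⊆T v with lookup S v in eq
... | false = z≤n
... | true  rewrite []=⇒lookup (S⊆T (lookup⇒[]= v S eq)) = ≤-refl

deg-mono : ∀ {n M} (w : Vec (Edge n) M) {S T : Subset n} → S ⊆ T → ∀ v → deg w S v ≤ deg w T v
deg-mono []            S⊆T v = z≤n
deg-mono ((a , b) ∷ w) {S} {T} S⊆T v rewrite deg-∷ S v a b w | deg-∷ T v a b w =
  +-mono-≤ (*-monoʳ-≤ ⟦ ⌊ a Fin.≟ v ⌋ ⟧ (⊆⇒⟦lookup⟧≤ S⊆T b))
    (+-mono-≤ (*-monoʳ-≤ ⟦ ⌊ b Fin.≟ v ⌋ ⟧ (⊆⇒⟦lookup⟧≤ S⊆T a)) (deg-mono w S⊆T v))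

∑-pick : ∀ {n} (f : Fin n → ℕ) a → ∑ (allFin n) (λ v → f v * ⟦ ⌊ a Fin.≟ v ⌋ ⟧) ≡ f a
∑-pick {n} f a = trans (∑-cong (allFin n) at-a)
  (trans (∑-distribˡ-* (allFin n) (f a) (λ v → ⟦ ⌊ a Fin.≟ v ⌋ ⟧))
    (trans (cong (f a *_) (∑-≟ a)) (*-identityʳ (f a))))
  where
  at-a : ∀ v → f v * ⟦ ⌊ a Fin.≟ v ⌋ ⟧ ≡ f a * ⟦ ⌊ a Fin.≟ v ⌋ ⟧
  at-a v with a Fin.≟ v
  ... | yes refl = refl
  ... | no  _    = trans (*-zeroʳ (f v)) (sym (*-zeroʳ (f a)))

handshake : ∀ {n M} (w : Vec (Edge n) M) (S : Subset n) →
            ∑ (allFin n) (λ v → ⟦ lookup S v ⟧ * deg w S v) ≡ 2 * span S w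
handshake {n} []            S = trans (∑-cong (allFin n) (λ v → *-zeroʳ ⟦ lookup S v ⟧)) (∑-0 (allFin n))
handshake {n} ((a , b) ∷ w) S = begin
  ∑ F (λ v → χ v * deg ((a , b) ∷ w) S v)
    ≡⟨ ∑-cong F (λ v → trans (cong (χ v *_) (deg-∷ S v a b w)) (e₁ (χ v) _ (χ b) _ (χ a) (deg w S v))) ⟩
  ∑ F (λ v → χ v * ⟦ ⌊ a Fin.≟ v ⌋ ⟧ * χ b + (χ v * ⟦ ⌊ b Fin.≟ v ⌋ ⟧ * χ a + χ v * deg w S v))
    ≡⟨ trans (∑-distrib-+ F (λ v → χ v * ⟦ ⌊ a Fin.≟ v ⌋ ⟧ * χ b) _)
             (cong (∑ F (λ v → χ v * ⟦ ⌊ a Fin.≟ v ⌋ ⟧ * χ b) +_) (∑-distrib-+ F (λ v → χ v * ⟦ ⌊ b Fin.≟ v ⌋ ⟧ * χ a) (λ v → χ v * deg w S v))) ⟩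
  ∑ F (λ v → χ v * ⟦ ⌊ a Fin.≟ v ⌋ ⟧ * χ b) + (∑ F (λ v → χ v * ⟦ ⌊ b Fin.≟ v ⌋ ⟧ * χ a) + ∑ F (λ v → χ v * deg w S v))
    ≡⟨ cong₂ _+_ (pick a (χ b)) (cong₂ _+_ (pick b (χ a)) (handshake w S)) ⟩
  χ a * χ b + (χ b * χ a + 2 * span S w)
    ≡⟨ e₂ (χ a) (χ b) (span S w) ⟩
  2 * (χ a * χ b + span S w)
    ≡⟨ cong (λ c → 2 * (c + span S w)) (⟦∧⟧ (lookup S a) (lookup S b)) ⟨
  2 * span S ((a , b) ∷ w) ∎
  where
  open ≡-Reasoning
  F = allFin n
  χ : Fin n → ℕ
  χ v = ⟦ lookup S v ⟧
  pick : ∀ a c → ∑ F (λ v → χ v * ⟦ ⌊ a Fin.≟ v ⌋ ⟧ * c) ≡ χ a * c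
  pick a c = trans (∑-distribʳ-* F c (λ v → χ v * ⟦ ⌊ a Fin.≟ v ⌋ ⟧)) (cong (_* c) (∑-pick χ a))
  e₁ : ∀ x p b q a d → x * (p * b + (q * a + d)) ≡ x * p * b + (x * q * a + x * d)
  e₁ = solve-∀
  e₂ : ∀ a b s → a * b + (b * a + 2 * s) ≡ 2 * (a * b + s)
  e₂ = solve-∀

-- Bad sets and greedy extension of colourings.

unused-colour : ∀ {p} (cs : List (Fin (3 + p))) → length cs ≤ 2 → ∃ λ c → c ∉ˡ cs
unused-colour cs short with zero ∈? cs | suc zero ∈? cs | suc (suc zero) ∈? cs
  where open DecMembership Fin._≟_ using (_∈?_)
... | no ∉ | _    | _    = _ , ∉
... | yes _ | no ∉ | _    = _ , ∉
... | yes _ | yes _ | no ∉ = _ , ∉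
... | yes i | yes j | yes k = ⊥-elim (full cs short i j k)
  where
  full : ∀ {p} (cs : List (Fin (3 + p))) → length cs ≤ 2 →
         zero ∈ˡ cs → suc zero ∈ˡ cs → suc (suc zero) ∈ˡ cs → ⊥
  full (_ ∷ _ ∷ _ ∷ _) (s≤s (s≤s ())) _ _ _
  full (_ ∷ _ ∷ []) _ (here refl) (there (here refl)) (here ())
  full (_ ∷ _ ∷ []) _ (here refl) (there (here refl)) (there (here ()))
  full (_ ∷ _ ∷ []) _ (there (here refl)) (here refl) (here ())
  full (_ ∷ _ ∷ []) _ (there (here refl)) (here refl) (there (here ()))
  full (_ ∷ _ ∷ []) _ (there (here refl)) (there (here ()))
  full (_ ∷ []) _ (here refl) (here ())

Bad : ∀ {n M} → Vec (Edge n) M → Subset n → Subset n → Set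
Bad w X T = ∀ v → v ∈ˢ T → 3 ≤ deg w (X ∪ T) v

bad? : ∀ {n M} (w : Vec (Edge n) M) X T → Dec (Bad w X T)
bad? w X T = all? λ v → (v ∈ˢ? T) →-dec (3 ≤? deg w (X ∪ T) v)

recolour : ∀ {n} {C : Set} → (Fin n → C) → Fin n → C → Fin n → C
recolour g v c u = if ⌊ u Fin.≟ v ⌋ then c else g u

recolour-≢ : ∀ {n} {C : Set} (g : Fin n → C) {v u} c → u ≢ v → recolour g v c u ≡ g u
recolour-≢ g {v} {u} c u≢v with u Fin.≟ v
... | yes u≡v = contradiction u≡v u≢v
... | no  _   = refl

recolour-proper : ∀ {n M p} (w : Vec (Edge n) M) {S S′ : Subset n} (g : Fin n → Fin p) v c →
  (∀ {u} → u ∈ˢ S → u ≢ v → u ∈ˢ S′) → IsPartialHom (graph w) p S′ g →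
  c ∉ˡ map g (neighbours S v w) → IsPartialHom (graph w) p S (recolour g v c)
recolour-proper w {S} g v c S⊆ proper c∉ x y x∈S y∈S xy eq with rel⇒edge w x y xy | x Fin.≟ v | y Fin.≟ v
... | _ , x≢y | yes refl | yes refl = x≢y refl
... | e , _   | yes refl | no  y≢v  = c∉ (subst (_∈ˡ map g (neighbours S v w)) (sym eq) (∈-map⁺ g (∈-neighboursˡ S e y∈S)))
... | e , _   | no  x≢v  | yes refl = c∉ (subst (_∈ˡ map g (neighbours S v w)) eq (∈-map⁺ g (∈-neighboursʳ S e x∈S)))
... | _       | no  x≢v  | no  y≢v  = proper x y (S⊆ x∈S x≢v) (S⊆ y∈S y≢v) xy eq

-- If U is bad for C, the last hypothesis puts it inside C and `g` already works. Otherwise some v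
-- in U has at most two neighbours in C ∪ U: the rest is coloured first, and one of the three or
-- more colours remains for v.
extend-colouring : ∀ {n M p} (w : Vec (Edge n) M) (C U : Subset n) (g : Fin n → Fin (3 + p)) →
  IsPartialHom (graph w) (3 + p) C g →
  (∀ U′ → U′ ⊆ U → Bad w C U′ → U′ ⊆ C) →
  ∃ λ g′ → IsPartialHom (graph w) (3 + p) (C ∪ U) g′ × (∀ y → y ∈ˢ C → g′ y ≡ g y)
extend-colouring {n} {M} {p} w C U g proper closed = go (suc ∣ U ∣) U ≤-refl closed
  where
  go : ∀ fuel U → ∣ U ∣ < fuel → (∀ U′ → U′ ⊆ U → Bad w C U′ → U′ ⊆ C) →
    ∃ λ g′ → IsPartialHom (graph w) (3 + p) (C ∪ U) g′ × (∀ y → y ∈ˢ C → g′ y ≡ g y)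
  go (suc fuel) U (s≤s ∣U∣≤fuel) closed with bad? w C U
  ... | yes bad = g , (λ x y x∈ y∈ → proper x y (⊆C x∈) (⊆C y∈)) , λ _ _ → refl
    where
    ⊆C : C ∪ U ⊆ C
    ⊆C = ∪-least id (closed U id bad)
  ... | no ¬bad with ¬∀⟶∃¬ n _ (λ v → (v ∈ˢ? U) →-dec (3 ≤? deg w (C ∪ U) v)) ¬bad
  ...   | v , ¬deg≥3 with v ∈ˢ? U
  ...     | no  v∉U = contradiction (λ v∈U → contradiction v∈U v∉U) ¬deg≥3
  ...     | yes v∈U
          with go fuel (U - v) (≤-trans (x∈p⇒∣p-x∣<∣p∣ v∈U) ∣U∣≤fuel)
                  (λ U′ U′⊆ → closed U′ (p─q⊆p U ⁅ v ⁆ ∘ U′⊆))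
  ...       | g₁ , proper₁ , agrees with v ∈ˢ? C
  -- A vertex of C keeps its colour; removing it from U has not changed C ∪ U.
  ...         | yes v∈C = g₁ , (λ x y x∈ y∈ → proper₁ x y (shrink x∈) (shrink y∈)) , agrees
    where
    shrink : C ∪ U ⊆ C ∪ (U - v)
    shrink {x} x∈ with x Fin.≟ v
    ... | yes refl = p⊆p∪q (U - v) v∈C
    ... | no  x≢v  = x∈p∪q∧x≢y⇒x∈p∪[q-y] C U x∈ x≢v
  ...         | no  v∉C with unused-colour (map g₁ (neighbours (C ∪ U) v w))
                               (≤-trans (≤-reflexive (length-map g₁ (neighbours (C ∪ U) v w)))
                                 (≮⇒≥ (λ 3≤deg → ¬deg≥3 (λ _ → 3≤deg))))
  ...           | c , c∉ = recolour g₁ v c , recolour-proper w g₁ v c (x∈p∪q∧x≢y⇒x∈p∪[q-y] C U) proper₁ c∉ ,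
                           λ y y∈C → trans (recolour-≢ g₁ c (λ { refl → v∉C y∈C })) (agrees y y∈C)

-- A closing set may meet X; this is harmless and avoids taking differences of sets.
record Closure {n M} (w : Vec (Edge n) M) (m : ℕ) (X T : Subset n) : Set where
  constructor closure
  field
    bad     : Bad w X T
    small   : ∣ T ∣ ≤ m
    maximal : ∀ T′ → Bad w X T′ → ∣ T′ ∣ ≤ m → T′ ⊆ T

Bad-∅ : ∀ {n M} (w : Vec (Edge n) M) X → Bad w X ∅
Bad-∅ w X v v∈∅ = contradiction v∈∅ ∉⊥

-- Degrees only grow with the surrounding set, so bad sets can be stacked.
Bad-∪ : ∀ {n M} (w : Vec (Edge n) M) X {T T′} → Bad w X T → Bad w (X ∪ T) T′ → Bad w X (T ∪ T′)
Bad-∪ w X {T} {T′} bad bad′ v v∈ with x∈p∪q⁻ T T′ v∈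
... | inj₁ v∈T  = ≤-trans (bad v v∈T) (deg-mono w (∪-mono-⊆ {p = X} id (p⊆p∪q T′)) v)
... | inj₂ v∈T′ = ≤-trans (bad′ v v∈T′)
  (deg-mono w (∪-least (∪-mono-⊆ {p = X} id (p⊆p∪q T′)) (q⊆p∪q X _ ∘ q⊆p∪q T T′)) v)

Bad-mono : ∀ {n M} (w : Vec (Edge n) M) {X X′} T → X ⊆ X′ → Bad w X T → Bad w X′ T
Bad-mono w T X⊆X′ bad v v∈T = ≤-trans (bad v v∈T) (deg-mono w (∪-mono-⊆ {q = T} X⊆X′ id) v)

-- Here 18 k is k for X plus 17 k = 8 k + (k + 8 k) for the largest bad set examined: a closing set
-- together with the vertices added in one extension.
module Consistency {n M : ℕ} (w : Vec (Edge n) M) (k p : ℕ)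
  (sparse : ∀ S → 1 ≤ ∣ S ∣ → ∣ S ∣ ≤ 18 * k → 3 * span S w ≤ 4 * ∣ S ∣) where

  open ≤-Reasoning

  -- Every vertex of T has degree at least 3 in X ∪ T, so the handshake identity and sparsity give 3
  -- |T| ≤ 2 `span` ≤ (8/3)(|X| + |T|). Because 8/3 < 3, this bounds T in terms of X.
  bad-size : ∀ X T → Bad w X T → ∣ X ∪ T ∣ ≤ 18 * k → ∣ T ∣ ≤ 8 * ∣ X ∣
  bad-size X T bad small with 1 ≤? ∣ X ∪ T ∣
  ... | no  empty = ≤-trans (≤-trans (∣q∣≤∣p∪q∣ X T) (≤-pred (≰⇒> empty))) z≤n
  ... | yes nonempty = +-cancelʳ-≤ (8 * ∣ T ∣) _ _ (begin
    ∣ T ∣ + 8 * ∣ T ∣                                                     ≡⟨ e₁ ∣ T ∣ ⟩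
    3 * (∣ T ∣ * 3)                                                       ≡⟨ cong (λ t → 3 * (t * 3)) (∑-lookup T) ⟨
    3 * (∑ (allFin n) (λ v → ⟦ lookup T v ⟧) * 3)                         ≡⟨ cong (3 *_) (∑-distribʳ-* (allFin n) 3 (λ v → ⟦ lookup T v ⟧)) ⟨
    3 * ∑ (allFin n) (λ v → ⟦ lookup T v ⟧ * 3)                           ≤⟨ *-monoʳ-≤ 3 (∑-mono (allFin n) bound) ⟩
    3 * ∑ (allFin n) (λ v → ⟦ lookup (X ∪ T) v ⟧ * deg w (X ∪ T) v)       ≡⟨ cong (3 *_) (handshake w (X ∪ T)) ⟩
    3 * (2 * span (X ∪ T) w)                                              ≡⟨ e₂ (span (X ∪ T) w) ⟩
    2 * (3 * span (X ∪ T) w)                                              ≤⟨ *-monoʳ-≤ 2 (sparse (X ∪ T) nonempty small) ⟩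
    2 * (4 * ∣ X ∪ T ∣)                                                   ≤⟨ *-monoʳ-≤ 2 (*-monoʳ-≤ 4 (∣p∪q∣≤∣p∣+∣q∣ X T)) ⟩
    2 * (4 * (∣ X ∣ + ∣ T ∣))                                             ≡⟨ e₃ ∣ X ∣ ∣ T ∣ ⟩
    8 * ∣ X ∣ + 8 * ∣ T ∣                                                 ∎)
    where
    e₁ : ∀ t → t + 8 * t ≡ 3 * (t * 3)
    e₁ = solve-∀
    e₂ : ∀ s → 3 * (2 * s) ≡ 2 * (3 * s)
    e₂ = solve-∀
    e₃ : ∀ x t → 2 * (4 * (x + t)) ≡ 8 * x + 8 * t
    e₃ = solve-∀
    bound : ∀ v → ⟦ lookup T v ⟧ * 3 ≤ ⟦ lookup (X ∪ T) v ⟧ * deg w (X ∪ T) v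
    bound v with lookup T v in eq
    ... | false = z≤n
    ... | true  rewrite []=⇒lookup (q⊆p∪q X T (lookup⇒[]= v T eq)) =
      *-monoʳ-≤ 1 (bad v (lookup⇒[]= v T eq))

  -- A gap in the sizes of bad sets: none lies above 8 |X| and up to 17 k. Unions of small bad sets
  -- therefore shrink back below 8 k.
  bad-small : ∀ X T → ∣ X ∣ ≤ k → Bad w X T → ∣ T ∣ ≤ 17 * k → ∣ T ∣ ≤ 8 * ∣ X ∣
  bad-small X T ∣X∣≤k bad small =
    bad-size X T bad (≤-trans (∣p∪q∣≤∣p∣+∣q∣ X T) (+-mono-≤ ∣X∣≤k small))

  -- All bad sets of size at most 8 k are united one at a time. Each union has size at most 16 k,
  -- and the gap brings it back to 8 k.
  exists-closure : ∀ X → ∣ X ∣ ≤ k → ∃ λ T → Closure w (8 * k) X T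
  exists-closure X ∣X∣≤k =
    let T , bad , small , maximal = collect (subsets n)
    in T , closure bad small λ T′ bad′ small′ → maximal T′ (∈-subsets T′) bad′ small′
    where
    collect : ∀ Ts → ∃ λ T → Bad w X T × ∣ T ∣ ≤ 8 * k ×
                (∀ T′ → T′ ∈ˡ Ts → Bad w X T′ → ∣ T′ ∣ ≤ 8 * k → T′ ⊆ T)
    collect [] = ∅ , Bad-∅ w X , ≤-trans (≤-reflexive (∣⊥∣≡0 n)) z≤n , λ _ ()
    collect (T₁ ∷ Ts) with collect Ts | bad? w X T₁ ×-dec (∣ T₁ ∣ ≤? 8 * k)
    ... | T , bad , small , maximal | no ¬adm = T , bad , small , λ
      { T′ (here refl) bad′ small′ → contradiction (bad′ , small′) ¬adm
      ; T′ (there T′∈) bad′ small′ → maximal T′ T′∈ bad′ small′ }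
    ... | T , bad , small , maximal | yes (bad₁ , small₁) =
      T ∪ T₁ , bad∪ , ≤-trans (bad-small X (T ∪ T₁) ∣X∣≤k bad∪ small∪) (*-monoʳ-≤ 8 ∣X∣≤k) , λ
      { T′ (here refl) bad′ small′ → q⊆p∪q T T′
      ; T′ (there T′∈) bad′ small′ → p⊆p∪q T₁ ∘ maximal T′ T′∈ bad′ small′ }
      where
      bad∪ : Bad w X (T ∪ T₁)
      bad∪ = Bad-∪ w X bad (Bad-mono w T₁ (p⊆p∪q T) bad₁)
      e₁ : ∀ k → 8 * k + 8 * k + k ≡ 17 * k
      e₁ = solve-∀
      small∪ : ∣ T ∪ T₁ ∣ ≤ 17 * k
      small∪ = begin
        ∣ T ∪ T₁ ∣                 ≤⟨ ∣p∪q∣≤∣p∣+∣q∣ T T₁ ⟩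
        ∣ T ∣ + ∣ T₁ ∣             ≤⟨ +-mono-≤ small small₁ ⟩
        8 * k + 8 * k              ≤⟨ m≤m+n _ k ⟩
        8 * k + 8 * k + k          ≡⟨ e₁ k ⟩
        17 * k                     ∎

  closure-mono : ∀ {X X′ T T′} → X ⊆ X′ → Closure w (8 * k) X T → Closure w (8 * k) X′ T′ → T ⊆ T′
  closure-mono {T = T} X⊆X′ (closure bad small _) (closure _ _ maximal) =
    maximal T (Bad-mono w T X⊆X′ bad) small

  ℋ : Subset n → (Fin n → Fin (3 + p)) → Set
  ℋ X f = ∣ X ∣ ≤ k × ∃ λ T → Closure w (8 * k) X T × ∃ λ g →
    IsPartialHom (graph w) (3 + p) (X ∪ T) g × (∀ y → y ∈ˢ X → g y ≡ f y)

  members-hom : ∀ X f → ℋ X f → IsPartialHom (graph w) (3 + p) X f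
  members-hom X f (_ , T , _ , g , proper , agrees) x y x∈X y∈X xy fx≡fy =
    proper x y (p⊆p∪q T x∈X) (p⊆p∪q T y∈X) xy
      (trans (agrees x x∈X) (trans fx≡fy (sym (agrees y y∈X))))

  ∣∅∣≤ : ∀ m → ∣ ∅ {n} ∣ ≤ m
  ∣∅∣≤ m = ≤-trans (≤-reflexive (∣⊥∣≡0 n)) z≤n

  -- For empty X the bound 8 |X| is 0. This makes properness vacuous in the first member of the
  -- strategy.
  closure-∅-empty : ∀ T → Closure w (8 * k) ∅ T → ∀ x → x ∉ˢ ∅ ∪ T
  closure-∅-empty T (closure bad small _) x x∈ = <⇒≱ (s≤s z≤n) (begin
    1                  ≡⟨ ∣⁅x⁆∣≡1 x ⟨
    ∣ ⁅ x ⁆ ∣          ≤⟨ p⊆q⇒∣p∣≤∣q∣ (λ z∈ → subst (_∈ˢ T) (sym (x∈⁅y⁆⇒x≡y x z∈)) x∈T) ⟩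
    ∣ T ∣              ≤⟨ bad-small ∅ T (∣∅∣≤ k) bad (≤-trans small (*-monoˡ-≤ k {8} {17} (m≤m+n 8 9))) ⟩
    8 * ∣ ∅ {n} ∣      ≡⟨ cong (8 *_) (∣⊥∣≡0 n) ⟩
    0                  ∎)
    where
    x∈T : x ∈ˢ T
    x∈T = [ (λ x∈∅ → contradiction x∈∅ ∉⊥) , id ]′ (x∈p∪q⁻ ∅ T x∈)

  nonempty : ℋ ∅ (λ _ → zero)
  nonempty =
    let T , cl = exists-closure ∅ (∣∅∣≤ k)
    in ∣∅∣≤ k , T , cl , (λ _ → zero) ,
       (λ x _ x∈ → contradiction x∈ (closure-∅-empty T cl x)) , λ _ _ → refl

  restrict : ∀ X Y f → ℋ X f → Y ⊆ X → ℋ Y f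
  restrict X Y f (∣X∣≤k , T , cl , g , proper , agrees) Y⊆X
    with exists-closure Y (≤-trans (p⊆q⇒∣p∣≤∣q∣ Y⊆X) ∣X∣≤k)
  ... | T′ , cl′ = ≤-trans (p⊆q⇒∣p∣≤∣q∣ Y⊆X) ∣X∣≤k , T′ , cl′ , g ,
    (λ x y x∈ y∈ → proper x y (shrink x∈) (shrink y∈)) , λ y y∈Y → agrees y (Y⊆X y∈Y)
    where
    shrink : Y ∪ T′ ⊆ X ∪ T
    shrink = ∪-mono-⊆ Y⊆X (closure-mono Y⊆X cl′ cl)

  ∣⁅x⁆∪X∣≤k : ∀ x (X : Subset n) → ∣ X ∣ < k → ∣ ⁅ x ⁆ ∪ X ∣ ≤ k
  ∣⁅x⁆∪X∣≤k x X ∣X∣<k = begin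
    ∣ ⁅ x ⁆ ∪ X ∣          ≤⟨ ∣p∪q∣≤∣p∣+∣q∣ ⁅ x ⁆ X ⟩
    ∣ ⁅ x ⁆ ∣ + ∣ X ∣      ≡⟨ cong (_+ ∣ X ∣) (∣⁅x⁆∣≡1 x) ⟩
    suc ∣ X ∣              ≤⟨ ∣X∣<k ⟩
    k                      ∎

  -- T ∪ U is bad for X and of size at most 17 k, hence at most 8 k by the gap; maximality of T then
  -- absorbs U.
  closure-closed : ∀ X T U → ∣ X ∣ ≤ k → Closure w (8 * k) X T → ∣ U ∣ ≤ k + 8 * k →
                   Bad w (X ∪ T) U → U ⊆ X ∪ T
  closure-closed X T U ∣X∣≤k (closure bad small maximal) ∣U∣≤ badU =
    q⊆p∪q X T ∘ maximal (T ∪ U) bad∪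
      (≤-trans (bad-small X (T ∪ U) ∣X∣≤k bad∪ small∪) (*-monoʳ-≤ 8 ∣X∣≤k)) ∘ q⊆p∪q T U
    where
    bad∪ : Bad w X (T ∪ U)
    bad∪ = Bad-∪ w X bad badU
    e₁ : ∀ k → 8 * k + (k + 8 * k) ≡ 17 * k
    e₁ = solve-∀
    small∪ : ∣ T ∪ U ∣ ≤ 17 * k
    small∪ = begin
      ∣ T ∪ U ∣                       ≤⟨ ∣p∪q∣≤∣p∣+∣q∣ T U ⟩
      ∣ T ∣ + ∣ U ∣                   ≤⟨ +-mono-≤ small ∣U∣≤ ⟩
      8 * k + (k + 8 * k)             ≡⟨ e₁ k ⟩
      17 * k                          ∎

  extend : ∀ X f → ℋ X f → ∣ X ∣ < k → ∀ x → x ∉ˢ X →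
           Σ (Fin n → Fin (3 + p)) λ g → ℋ (⁅ x ⁆ ∪ X) g × (∀ y → y ∈ˢ X → g y ≡ f y)
  extend X f (∣X∣≤k , T , cl , g , proper , agrees) ∣X∣<k x x∉X =
    let T′ , cl′ = exists-closure (⁅ x ⁆ ∪ X) (∣⁅x⁆∪X∣≤k x X ∣X∣<k)
        -- Only x and the new closing set T′ have to be coloured. Every part of them that is bad for
        -- X ∪ T already lies there, so the colours given by `g` stay.
        h , proper′ , agrees′ = extend-colouring w (X ∪ T) (⁅ x ⁆ ∪ T′) g proper
          λ U U⊆ → closure-closed X T U ∣X∣≤k cl (≤-trans (p⊆q⇒∣p∣≤∣q∣ U⊆) (size≤ T′ (Closure.small cl′)))
    in h , (∣⁅x⁆∪X∣≤k x X ∣X∣<k , T′ , cl′ , h ,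
            (λ u v u∈ v∈ → proper′ u v (cover T′ u∈) (cover T′ v∈)) , λ _ _ → refl) ,
       λ y y∈X → trans (agrees′ y (p⊆p∪q T y∈X)) (agrees y y∈X)
    where
    size≤ : ∀ T′ → ∣ T′ ∣ ≤ 8 * k → ∣ ⁅ x ⁆ ∪ T′ ∣ ≤ k + 8 * k
    size≤ T′ small′ = begin
      ∣ ⁅ x ⁆ ∪ T′ ∣          ≤⟨ ∣p∪q∣≤∣p∣+∣q∣ ⁅ x ⁆ T′ ⟩
      ∣ ⁅ x ⁆ ∣ + ∣ T′ ∣      ≡⟨ cong (_+ ∣ T′ ∣) (∣⁅x⁆∣≡1 x) ⟩
      1 + ∣ T′ ∣              ≤⟨ +-mono-≤ (≤-trans (s≤s z≤n) ∣X∣<k) small′ ⟩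
      k + 8 * k               ∎
    cover : ∀ T′ → (⁅ x ⁆ ∪ X) ∪ T′ ⊆ (X ∪ T) ∪ (⁅ x ⁆ ∪ T′)
    cover T′ = ∪-least
      (∪-least (q⊆p∪q (X ∪ T) _ ∘ p⊆p∪q T′) (p⊆p∪q _ ∘ p⊆p∪q T))
      (q⊆p∪q (X ∪ T) _ ∘ q⊆p∪q ⁅ x ⁆ T′)

  strategy : IsStrategy k (graph w) (3 + p) ℋ
  strategy = record
    { members-hom = members-hom
    ; nonempty    = ∅ , (λ _ → zero) , nonempty
    ; restrict    = restrict
    ; extend      = extend
    }

-- Colour classes and the linear lower bound.

colour-class : ∀ {n q} → (Fin n → Fin q) → Fin q → Subset n
colour-class f c = tabulate (λ v → ⌊ f v Fin.≟ c ⌋)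

∈-colour-class : ∀ {n q} (f : Fin n → Fin q) c {v} → v ∈ˢ colour-class f c → f v ≡ c
∈-colour-class f c {v} v∈ with f v Fin.≟ c | trans (sym (lookup∘tabulate (λ u → ⌊ f u Fin.≟ c ⌋) v)) ([]=⇒lookup v∈)
... | yes eq | _ = eq

∑-colour-class : ∀ {n q} (f : Fin n → Fin q) → ∑ (allFin q) (λ c → ∣ colour-class f c ∣) ≡ n
∑-colour-class {n} {q} f = begin
  ∑ (allFin q) (λ c → ∣ colour-class f c ∣)
    ≡⟨ ∑-cong (allFin q) (λ c → trans (sym (∑-lookup (colour-class f c)))
         (∑-cong (allFin n) (λ v → cong ⟦_⟧ (lookup∘tabulate (λ u → ⌊ f u Fin.≟ c ⌋) v)))) ⟩
  ∑ (allFin q) (λ c → ∑ (allFin n) (λ v → ⟦ ⌊ f v Fin.≟ c ⌋ ⟧))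
    ≡⟨ ∑-swap (allFin q) (allFin n) (λ c v → ⟦ ⌊ f v Fin.≟ c ⌋ ⟧) ⟩
  ∑ (allFin n) (λ v → ∑ (allFin q) (λ c → ⟦ ⌊ f v Fin.≟ c ⌋ ⟧))
    ≡⟨ trans (∑-cong (allFin n) (λ v → ∑-≟ (f v))) (∑-allFin-1 n) ⟩
  n ∎
  where open ≡-Reasoning

large-colour-class : ∀ {q R} → 1 ≤ q → (f : Fin (q * R) → Fin q) → ∃ λ c → R ≤ ∣ colour-class f c ∣
large-colour-class {q} {R} 1≤q f =
  -- Adding 1 to each class size makes the comparison of sums strict, as q ≥ 1.
  let c , R<1+ = ∑<⇒∃< (allFin q) {λ _ → R} {λ c → 1 + ∣ colour-class f c ∣} (begin-strict
        ∑ (allFin q) (λ _ → R)                             ≡⟨ ∑-cong (allFin q) (λ _ → sym (*-identityʳ R)) ⟩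
        ∑ (allFin q) (λ _ → R * 1)                         ≡⟨ ∑-distribˡ-* (allFin q) R (λ _ → 1) ⟩
        R * ∑ (allFin q) (λ _ → 1)                         ≡⟨ cong (R *_) (∑-allFin-1 q) ⟩
        R * q                                              ≡⟨ *-comm R q ⟩
        q * R                                              <⟨ m<n+m (q * R) 1≤q ⟩
        q + q * R                                          ≡⟨ cong₂ _+_ (∑-allFin-1 q) (∑-colour-class f) ⟨
        ∑ (allFin q) (λ _ → 1) + ∑ (allFin q) (λ c → ∣ colour-class f c ∣)
                                                           ≡⟨ ∑-distrib-+ (allFin q) (λ _ → 1) (λ c → ∣ colour-class f c ∣) ⟨
        ∑ (allFin q) (λ c → 1 + ∣ colour-class f c ∣)      ∎)
  in c , ≤-pred R<1+
  where open ≤-Reasoning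

chords⇒¬Hom : ∀ {q R M} (w : Vec (Edge (q * R)) M) → 1 ≤ q →
              (∀ S → R ≤ ∣ S ∣ → HasChord w S) → ¬ Hom (graph w) q
chords⇒¬Hom w 1≤q chords (f , hom) =
  let c , R≤ = large-colour-class 1≤q f
      u , v , e∈w , u∈ , v∈ , u≢v = chords (colour-class f c) R≤
  in hom u v (edge⇒rel w u v e∈w u≢v) (trans (∈-colour-class f c u∈) (sym (∈-colour-class f c v∈)))

¬SublinearWidth : ∀ p q → 1 ≤ q → ¬ SublinearWidth (3 + p) q
¬SublinearWidth p q@(suc q′) 1≤q (k , o[n] , solvable) =
  let w , sparse , chords = sparse-graph q R a (18 * k n) 1≤a refl (m≤m+n (2 * q) N) 2≤n small
  in chords⇒¬Hom w 1≤q chords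
       (solvable (graph w) (Consistency.ℋ w (k n) p sparse , Consistency.strategy w (k n) p sparse))
  where
  a Z N R n : ℕ
  a = pred (2 * (q * q))
  Z = 8 * threshold (2 * a) ^ 3
  1≤Z*18 : 1 ≤ Z * 18
  1≤Z*18 = *-mono-≤ {1} {Z} {1} {18}
    (*-mono-≤ {1} {8} (s≤s z≤n) (m^n>0 (threshold (2 * a)) {{>-nonZero (*-mono-≤ {1} {4} (s≤s z≤n) (m^n>0 2 (16 * suc (2 * a))))}} 3))
    (s≤s z≤n)
  -- The factor 18 Z makes sets of up to 18 k(n) vertices small enough for `sparse-graph`. In R, the
  -- summand 2q satisfies its condition on R and N makes n large enough for the little-o bound.
  N = proj₁ (o[n] (Z * 18) 1≤Z*18)
  R = 2 * q + N
  n = q * R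
  1≤a : 1 ≤ a
  1≤a = ≤-pred (*-monoʳ-≤ 2 (*-mono-≤ 1≤q 1≤q))
  R≤n : R ≤ n
  R≤n = m≤m+n R (q′ * R)
  2≤n : 2 ≤ n
  2≤n = ≤-trans (*-monoʳ-≤ 2 1≤q) (≤-trans (m≤m+n (2 * q) N) R≤n)
  small : Z * (18 * k n) ≤ n
  small = subst (_≤ n) (*-assoc Z 18 (k n))
    (proj₂ (o[n] (Z * 18) 1≤Z*18) n (≤-trans (m≤n+m N (2 * q)) R≤n))

-- Two colours

module Width3 {I : Instance} {m : ℕ} {ℋ : Subset (size I) → (Fin (size I) → Fin m) → Set}
              (isStrategy : IsStrategy 3 I m ℋ) where
  open IsStrategy isStrategy

  -- Also admits x inside X, where `extend` does not apply but restriction does.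
  visit : ∀ X f → ℋ X f → ∣ X ∣ < 3 → ∀ x →
          ∃ λ g → ℋ (⁅ x ⁆ ∪ X) g × (∀ y → y ∈ˢ X → g y ≡ f y)
  visit X f h ∣X∣<3 x with x ∈ˢ? X
  ... | no  x∉X = extend X f h ∣X∣<3 x x∉X
  ... | yes x∈X = f , restrict X (⁅ x ⁆ ∪ X) f h
      (∪-least (λ z∈ → subst (_∈ˢ X) (sym (x∈⁅y⁆⇒x≡y x z∈)) x∈X) id) , λ _ _ → refl

  ∣⁅x⁆∪⁅y⁆∣<3 : ∀ (x y : Fin (size I)) → ∣ ⁅ x ⁆ ∪ ⁅ y ⁆ ∣ < 3
  ∣⁅x⁆∪⁅y⁆∣<3 x y = s≤s (≤-trans (∣p∪q∣≤∣p∣+∣q∣ ⁅ x ⁆ ⁅ y ⁆)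
    (≤-reflexive (cong₂ _+_ (∣⁅x⁆∣≡1 x) (∣⁅x⁆∣≡1 y))))

  visit-pair : ∀ x y → ∃ λ X → ∃ λ f → ℋ X f × x ∈ˢ X × y ∈ˢ X
  visit-pair x y =
    let X₀ , f₀ , h₀ = nonempty
        f₁ , h₁ , _  = visit ∅ f₀ (restrict X₀ ∅ f₀ h₀ ⊥⊆) (s≤s (≤-trans (≤-reflexive (∣⊥∣≡0 (size I))) z≤n)) y
        h₁′          = restrict (⁅ y ⁆ ∪ ∅) ⁅ y ⁆ f₁ h₁ (p⊆p∪q ∅)
        f₂ , h₂ , _  = visit ⁅ y ⁆ f₁ h₁′ (s≤s (≤-trans (≤-reflexive (∣⁅x⁆∣≡1 y)) (s≤s z≤n))) x
    in ⁅ x ⁆ ∪ ⁅ y ⁆ , f₂ , h₂ , p⊆p∪q ⁅ y ⁆ (x∈⁅x⁆ x) , q⊆p∪q ⁅ x ⁆ ⁅ y ⁆ (x∈⁅x⁆ y)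

Fin1-unique : ∀ (a b : Fin 1) → a ≡ b
Fin1-unique zero zero = refl

-- Some member of the strategy contains both ends of any given edge, and with one colour it cannot
-- be proper; so the instance has no edges.
solvable₁ : ∀ q → 1 ≤ q → SolvableInWidth 1 q (λ _ → 3)
solvable₁ (suc q) _ I (ℋ , isStrategy) = (λ _ → zero) , λ x y xy _ →
  let X , f , h , x∈X , y∈X = visit-pair x y
  in members-hom X f h x y x∈X y∈X xy (Fin1-unique (f x) (f y))
  where
  open IsStrategy isStrategy
  open Width3 isStrategy

bit : Fin 2 → Bool
bit zero       = false
bit (suc zero) = true

bit-≢ : ∀ a b → a ≢ b → bit b ≡ bit a xor true
bit-≢ zero       zero       a≢b = contradiction refl a≢b
bit-≢ zero       (suc zero) a≢b = refl
bit-≢ (suc zero) zero       a≢b = refl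
bit-≢ (suc zero) (suc zero) a≢b = contradiction refl a≢b

xor-solve : ∀ a b c → b ≡ a xor c → a ≡ b xor c
xor-solve false false false refl = refl
xor-solve false true  true  refl = refl
xor-solve true  true  false refl = refl
xor-solve true  false true  refl = refl

xor-cancelˡ : ∀ a b c → a xor b ≡ a xor c → b ≡ c
xor-cancelˡ false b     c     eq = eq
xor-cancelˡ true  false false eq = refl
xor-cancelˡ true  true  true  eq = refl

xor-true-≢ : ∀ a → a xor true ≢ a
xor-true-≢ false ()
xor-true-≢ true  ()

module TwoColouring {I : Instance} {ℋ : Subset (size I) → (Fin (size I) → Fin 2) → Set}
                    (isStrategy : IsStrategy 3 I 2 ℋ) where
  open IsStrategy isStrategy
  open Width3 isStrategy

  private
    V = Fin (size I)

  -- The bit is a parity: `false` forces equal colours and `true` different ones.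
  Forced : V → V → Bool → Set
  Forced x y b = ∀ X f → ℋ X f → x ∈ˢ X → y ∈ˢ X → bit (f y) ≡ bit (f x) xor b

  forced-sym : ∀ {x y b} → Forced x y b → Forced y x b
  forced-sym {b = b} xy X f h y∈X x∈X = xor-solve _ _ b (xy X f h x∈X y∈X)

  forced-refl : ∀ x → Forced x x false
  forced-refl x X f h _ _ = sym (xor-identityʳ (bit (f x)))

  -- A member containing x and z is cut down to these two points, and width 3 leaves room to extend
  -- it to y; the parities then add up.
  forced-trans : ∀ {x y z b c} → Forced x y b → Forced y z c → Forced x z (b xor c)
  forced-trans {x} {y} {z} {b} {c} xy yz X f h x∈X z∈X =
    let P              = ⁅ x ⁆ ∪ ⁅ z ⁆
        P⊆X            = ∪-least {p = ⁅ x ⁆} {⁅ z ⁆}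
                           (λ u∈ → subst (_∈ˢ X) (sym (x∈⁅y⁆⇒x≡y x u∈)) x∈X)
                           (λ u∈ → subst (_∈ˢ X) (sym (x∈⁅y⁆⇒x≡y z u∈)) z∈X)
        g , h′ , agree = visit P f (restrict X P f h P⊆X) (∣⁅x⁆∪⁅y⁆∣<3 x z) y
        x∈P            = p⊆p∪q ⁅ z ⁆ (x∈⁅x⁆ x)
        z∈P            = q⊆p∪q ⁅ x ⁆ ⁅ z ⁆ (x∈⁅x⁆ z)
        y∈             = p⊆p∪q P (x∈⁅x⁆ y)
        x∈             = q⊆p∪q ⁅ y ⁆ P x∈P
        z∈             = q⊆p∪q ⁅ y ⁆ P z∈P
    in begin
      bit (f z)                       ≡⟨ cong bit (agree z z∈P) ⟨
      bit (g z)                       ≡⟨ yz _ g h′ y∈ z∈ ⟩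
      bit (g y) xor c                 ≡⟨ cong (_xor c) (xy _ g h′ x∈ y∈) ⟩
      (bit (g x) xor b) xor c         ≡⟨ xor-assoc (bit (g x)) b c ⟩
      bit (g x) xor (b xor c)         ≡⟨ cong (λ a → bit a xor (b xor c)) (agree x x∈P) ⟩
      bit (f x) xor (b xor c)         ∎
    where open ≡-Reasoning

  -- Some member contains both points, so a forced parity is never vacuous.
  forced-unique : ∀ {x y b c} → Forced x y b → Forced x y c → b ≡ c
  forced-unique {x} {y} {b} {c} xy xy′ =
    let X , f , h , x∈X , y∈X = visit-pair x y
    in xor-cancelˡ (bit (f x)) b c (trans (sym (xy X f h x∈X y∈X)) (xy′ X f h x∈X y∈X))

  forced-edge : ∀ {x y} → rel I x y ≡ true → Forced x y true
  forced-edge {x} {y} xy X f h x∈X y∈X = bit-≢ (f x) (f y) (members-hom X f h x y x∈X y∈X xy)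

  -- Each vertex carries the root of its component and the colour forced relative to that root.
  record Components (es : List (V × V)) : Set where
    field
      root   : V → V
      colour : V → Bool
      forced : ∀ v → Forced (root v) v (colour v)
      joined : ∀ {u v} → (u , v) ∈ˡ es → rel I u v ≡ true → root u ≡ root v × colour u ≢ colour v

  components : ∀ es → Components es
  components [] = record
    { root = id ; colour = λ _ → false ; forced = forced-refl ; joined = λ () }
  components ((x , y) ∷ es) = add (rel I x y Bool.≟ true) (root x Fin.≟ root y)
    where
    open Components (components es)
    add : Dec (rel I x y ≡ true) → Dec (root x ≡ root y) → Components ((x , y) ∷ es)
    add (no ¬xy) _ = record
      { root = root ; colour = colour ; forced = forced
      ; joined = λ { (here refl) xy → contradiction xy ¬xy ; (there e) → joined e } }
    add (yes xy) (yes same) = record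
      { root = root ; colour = colour ; forced = forced
      ; joined = λ { (here refl) _ → same , differ ; (there e) → joined e } }
      where
      differ : colour x ≢ colour y
      -- The parity from the common root to y is forced both through x and the edge, and by
      -- `forced y`; uniqueness equates the two.
      differ eq = xor-true-≢ (colour x) (trans
        (forced-unique (forced-trans (forced x) (forced-edge xy))
                       (subst (λ r → Forced r y (colour y)) (sym same) (forced y)))
        (sym eq))
    add (yes xy) (no distinct) = record
      { root = root′ ; colour = colour′ ; forced = forced′ ; joined = joined′ }
      where
      -- Parity from the root of x to the root of y through the new edge; the component of y is
      -- rerooted at the root of x and its colours are shifted by this amount.
      shift : Bool
      shift = (colour x xor true) xor colour y
      bridge : Forced (root x) (root y) shift
      bridge = forced-trans (forced-trans (forced x) (forced-edge xy)) (forced-sym (forced y))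
      root′ : V → V
      root′ v = if ⌊ root v Fin.≟ root y ⌋ then root x else root v
      colour′ : V → Bool
      colour′ v = if ⌊ root v Fin.≟ root y ⌋ then shift xor colour v else colour v
      forced′ : ∀ v → Forced (root′ v) v (colour′ v)
      forced′ v with root v Fin.≟ root y
      ... | no  _  = forced v
      ... | yes eq = forced-trans bridge (subst (λ r → Forced r v (colour v)) eq (forced v))
      joined′ : ∀ {u v} → (u , v) ∈ˡ (x , y) ∷ es → rel I u v ≡ true →
                root′ u ≡ root′ v × colour′ u ≢ colour′ v
      joined′ (here refl) _ with root x Fin.≟ root y | root y Fin.≟ root y
      ... | yes same | _       = contradiction same distinct
      ... | no  _    | no  ≢   = contradiction refl ≢
      ... | no  _    | yes _   = refl , λ eq → xor-true-≢ (colour x) (sym (begin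
        colour x                                           ≡⟨ eq ⟩
        shift xor colour y                                 ≡⟨ xor-assoc (colour x xor true) (colour y) (colour y) ⟩
        (colour x xor true) xor (colour y xor colour y)    ≡⟨ cong ((colour x xor true) xor_) (xor-same (colour y)) ⟩
        (colour x xor true) xor false                      ≡⟨ xor-identityʳ _ ⟩
        colour x xor true                                  ∎))
        where open ≡-Reasoning
      joined′ {u} {v} (there e) uv with joined e uv
      ... | same , differ with root u Fin.≟ root y | root v Fin.≟ root y
      ...   | yes _  | yes _  = refl , differ ∘ xor-cancelˡ shift (colour u) (colour v)
      ...   | no  _  | no  _  = same , differ
      ...   | yes p  | no  ¬p = contradiction (trans (sym same) p) ¬p
      ...   | no  ¬p | yes p  = contradiction (trans same p) ¬p

  two-colouring : ∃ λ (colour : V → Bool) → ∀ x y → rel I x y ≡ true → colour x ≢ colour y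
  two-colouring = colour , λ x y xy → proj₂ (joined (∈-cartesianProduct⁺ (∈-allFin x) (∈-allFin y)) xy)
    where open Components (components (pairs (size I)))

solvable₂ : ∀ q → 2 ≤ q → SolvableInWidth 2 q (λ _ → 3)
solvable₂ (suc zero) (s≤s ())
solvable₂ (suc (suc q)) _ I (ℋ , isStrategy) =
  (λ v → embed (colour v)) , λ x y xy eq → proper x y xy (embed-injective _ _ eq)
  where
  colour = proj₁ (TwoColouring.two-colouring isStrategy)
  proper = proj₂ (TwoColouring.two-colouring isStrategy)
  embed : Bool → Fin (2 + q)
  embed false = zero
  embed true  = suc zero
  embed-injective : ∀ a b → embed a ≡ embed b → a ≡ b
  embed-injective false false _ = refl
  embed-injective true  true  _ = refl

-- The equivalences.

width3⇒bounded : ∀ {p q} → SolvableInWidth p q (λ _ → 3) → BoundedWidth p q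
width3⇒bounded solvable = (λ _ → 3) , (3 , 0 , λ _ _ → ≤-refl) , solvable

bounded⇒sublinear : ∀ {p q} → BoundedWidth p q → SublinearWidth p q
bounded⇒sublinear (k , (c , N , k≤c) , solvable) = k , (λ m _ → N ⊔ m * c , λ n N≤n →
  ≤-trans (*-monoʳ-≤ m (k≤c n (≤-trans (m≤m⊔n N (m * c)) N≤n)))
          (≤-trans (m≤n⊔m N (m * c)) N≤n)) , solvable

sublinear⇒≤2 : ∀ {p q} → 1 ≤ p → p ≤ q → SublinearWidth p q → p ≡ 1 ⊎ p ≡ 2
sublinear⇒≤2 {1}                  _ _   _         = inj₁ refl
sublinear⇒≤2 {2}                  _ _   _         = inj₂ refl
sublinear⇒≤2 {suc (suc (suc p))} {q} _ p≤q sublinear =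
  contradiction sublinear (¬SublinearWidth p q (≤-trans (s≤s z≤n) p≤q))

≤2⇒width3 : ∀ {p q} → p ≤ q → p ≡ 1 ⊎ p ≡ 2 → SolvableInWidth p q (λ _ → 3)
≤2⇒width3 {q = q} p≤q (inj₁ refl) = solvable₁ q p≤q
≤2⇒width3 {q = q} p≤q (inj₂ refl) = solvable₂ q p≤q

theorem6p1 : ∀ (p q : ℕ) → 1 ≤ p → p ≤ q →
    (SolvableInWidth p q (λ _ → 3) ⇔ BoundedWidth p q)
    × (BoundedWidth p q ⇔ SublinearWidth p q)
    × (SublinearWidth p q ⇔ (p ≡ 1 ⊎ p ≡ 2))
theorem6p1 p q 1≤p p≤q =
    mk⇔ width3⇒bounded (d⇒a ∘ c⇒d ∘ bounded⇒sublinear)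
  , mk⇔ bounded⇒sublinear (width3⇒bounded ∘ d⇒a ∘ c⇒d)
  , mk⇔ c⇒d (bounded⇒sublinear ∘ width3⇒bounded ∘ d⇒a)
  where
  c⇒d : SublinearWidth p q → p ≡ 1 ⊎ p ≡ 2
  c⇒d = sublinear⇒≤2 1≤p p≤q
  d⇒a : p ≡ 1 ⊎ p ≡ 2 → SolvableInWidth p q (λ _ → 3)
  d⇒a = ≤2⇒width3 p≤q
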